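{- For $p\in[1,\infty]$, in the matrix-vector model, a one-sided non-adaptive $(\epsilon,\ell_p)$-tester for real symmetric $d\times d$ matrices must make at least $\Omega\!\left(\frac{1}{\epsilon}d^{1-1/p}\right)$ queries.
   Context: For a real symmetric $d\times d$ matrix $A$, $\|A\|_p$ denotes the Schatten-$p$ norm (the $\ell_p$ norm of the vector of singular values; $\|A\|_\infty$ is the operator norm), and $\lambda_{\min}(A)$ is its smallest eigenvalue. PSD means positive semidefinite. The parameter $\epsilon$ satisfies $0<\epsilon<1$, and $1/p=0$ when $p=\infty$. In the matrix-vector model an algorithm accesses an unknown real symmetric $d\times d$ matrix $A$ through queries in which it chooses a vector $v\in\mathbb{R}^d$ and receives the vector $Av$; it is non-adaptive if the queries do not depend on the answers to other queries. For $p\in[1,\infty]$, an $(\epsilon,\ell_p)$-tester is a (randomized) algorithm that makes such queries to $A$, outputs True with probability at least $2/3$ if $A$ is PSD, and outputs False with probability at least $2/3$ if $A$ is $\epsilon\|A\|_p$-far in spectral distance from the PSD cone, or equivalently if $\lambda_{\min}(A)\le-\epsilon\|A\|_p$. The tester is one-sided (has one-sided error) if it is guaranteed to output True on all PSD inputs, even if the input is generated by an adversary with access to the random coins of the tester. $\Omega(\cdot)$ is the standard asymptotic notation.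
   Formalization: Since d queries always suffice, Ω cannot be uniform in all parameters: its constant depends on a bound ε₀<1 for ε and a K with d^{1-1/p}/ε ≤ K·d (automatic for K=1/ε); the tester need reject only far A with λ_min(A)<0, i.e. A≠0. -}

module Defs where

open import Algebra.Bundles using (CommutativeRing; Semiring)
open import Data.Bool.Base using (Bool; true; false)
open import Data.Fin.Base using (Fin; toℕ)
open import Data.Nat.Base using (ℕ; suc)
open import Data.Product.Base using (∃; ∃₂; _×_)
open import Data.Vec.Functional using (Vector)
open import Level using (0ℓ)
open import Relation.Binary.Core using (Rel)
open import Relation.Binary.PropositionalEquality.Core using (_≡_; _≢_)
open import Relation.Binary.Structures using (IsTotalOrder)
open import Relation.Nullary.Negation.Core using (¬_)
open import Relation.Unary using (Pred; _∈_; _≐_; _⊥_; U; ∁; ⋃)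

import Algebra.Definitions.RawSemiring as RawSemiringDefinitions
import Relation.Binary.Construct.NonStrictToStrict as NonStrictToStrict

-- The real numbers are, up to unique isomorphism, the complete ordered field.
-- As usual, the value of 0# ⁻¹ is left unspecified.
record CompleteOrderedField : Set₁ where
  infix  8 _⁻¹
  infix  4 _≤_
  field
    commutativeRing : CommutativeRing 0ℓ 0ℓ

  open CommutativeRing commutativeRing public

  field
    _⁻¹          : Carrier → Carrier
    _≤_          : Rel Carrier 0ℓ
    1≉0          : ¬ 1# ≈ 0#
    ⁻¹-inverseʳ  : ∀ x → ¬ x ≈ 0# → x * x ⁻¹ ≈ 1#
    isTotalOrder : IsTotalOrder _≈_ _≤_
    +-monoˡ-≤    : ∀ z {x y} → x ≤ y → x + z ≤ y + z
    *-nonNeg     : ∀ {x y} → 0# ≤ x → 0# ≤ y → 0# ≤ x * y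

  IsUpperBound : Pred Carrier 0ℓ → Carrier → Set
  IsUpperBound S b = ∀ x → x ∈ S → x ≤ b

  IsLub : Pred Carrier 0ℓ → Carrier → Set
  IsLub S s = IsUpperBound S s × (∀ b → IsUpperBound S b → s ≤ b)

  field
    complete : ∀ S → ∃ S → ∃ (IsUpperBound S) → ∃ (IsLub S)

  open NonStrictToStrict _≈_ _≤_ public using (_<_)
  open RawSemiringDefinitions (Semiring.rawSemiring semiring) public
    using (_^_; sum) renaming (_×_ to _×ᴺ_)

  fromℕ : ℕ → Carrier
  fromℕ n = n ×ᴺ 1#

module Reals (ℝ : CompleteOrderedField) where

  open CompleteOrderedField ℝ

  -- RationalPowers x a z: z = x ^ q for some rational q = m / (n + 1) ≤ a.
  RationalPowers : Carrier → Carrier → Pred Carrier 0ℓ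
  RationalPowers x a z = ∃₂ λ m n →
    fromℕ m ≤ a * fromℕ (suc n) × 0# ≤ z × z ^ suc n ≈ x ^ m

  -- IsPow x a y: y = x ^ a, for x ≥ 0 and a real exponent a ≥ 0.
  -- The value of 0 ^ 0 is left undefined; it is never needed.
  data IsPow (x a y : Carrier) : Set where
    base≥1 : 1# ≤ x → 0# ≤ a → IsLub (RationalPowers x a) y → IsPow x a y
    base<1 : ∀ w → 0# < x → x < 1# → 0# ≤ a →
             IsLub (RationalPowers (x ⁻¹) a) w → y ≈ w ⁻¹ → IsPow x a y
    base≈0 : x ≈ 0# → 0# < a → y ≈ 0# → IsPow x a y

  data Exponent : Set where
    finite : (p : Carrier) → 1# ≤ p → Exponent
    ∞      : Exponent

  1/_ : Exponent → Carrier
  1/ finite p _ = p ⁻¹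
  1/ ∞          = 0#

  Vec : ℕ → Set
  Vec = Vector Carrier

  Matrix : ℕ → Set
  Matrix d = Fin d → Fin d → Carrier

  infix 4 _≋_

  _≋_ : ∀ {d} → Rel (Vec d) 0ℓ
  v ≋ w = ∀ i → v i ≈ w i

  0ᵛ : ∀ {d} → Vec d
  0ᵛ _ = 0#

  infixr 7 _·_ _*ᵥ_

  _·_ : ∀ {d} → Vec d → Vec d → Carrier
  v · w = sum λ i → v i * w i

  _*ᵥ_ : ∀ {d} → Matrix d → Vec d → Vec d
  (A *ᵥ v) i = A i · v

  Symmetric : ∀ {d} → Matrix d → Set
  Symmetric A = ∀ i j → A i j ≈ A j i

  PSD : ∀ {d} → Matrix d → Set
  PSD A = Symmetric A × (∀ v → 0# ≤ v · A *ᵥ v)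

  IsEigenvalue : ∀ {d} → Matrix d → Carrier → Set
  IsEigenvalue A μ = ∃ λ v → ¬ v ≋ 0ᵛ × A *ᵥ v ≋ λ i → μ * v i

  IsSmallestEigenvalue : ∀ {d} → Matrix d → Carrier → Set
  IsSmallestEigenvalue A μ = IsEigenvalue A μ × (∀ ν → IsEigenvalue A ν → μ ≤ ν)

  Orthogonal : ∀ {d} → Matrix d → Set
  Orthogonal {d} Q = (∀ i → column i · column i ≈ 1#)
                   × (∀ i j → i ≢ j → column i · column j ≈ 0#)
    where
    column : Fin d → Vec d
    column j i = Q i j

  -- A = P diag(σ) Qᵀ is a singular value decomposition.
  record AreSingularValues {d} (A : Matrix d) (σ : Vec d) : Set where
    field
      left right      : Matrix d
      left-orthogonal  : Orthogonal left
      right-orthogonal : Orthogonal right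
      nonNeg           : ∀ i → 0# ≤ σ i
      decomposition    : ∀ i j → A i j ≈ sum λ l → left i l * σ l * right j l

  -- The ℓₚ norm of a vector with nonnegative entries.
  IsℓNorm : ∀ {d} → Exponent → Vec d → Carrier → Set
  IsℓNorm (finite p 1≤p) σ s = ∃ λ τ →
    (∀ i → IsPow (σ i) p (τ i)) × IsPow (sum τ) (1/ finite p 1≤p) s
  IsℓNorm ∞ σ s = (∀ i → σ i ≤ s) × ∃ λ i → s ≈ σ i

  IsSchattenNorm : ∀ {d} → Exponent → Matrix d → Carrier → Set
  IsSchattenNorm p A s = ∃ λ σ → AreSingularValues A σ × IsℓNorm p σ s

  -- λ_min(A) ≤ - ε ‖A‖ₚ.  The condition λ_min(A) < 0 excludes only A = 0
  -- (when ε > 0), which is PSD and yet satisfies the inequality; without it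
  -- no tester could exist.
  IsFar : ∀ {d} → Exponent → Carrier → Matrix d → Set
  IsFar p ε A = ∃₂ λ s μ → IsSchattenNorm p A s × IsSmallestEigenvalue A μ
                         × μ < 0# × μ ≤ - (ε * s)

  -- `pr` is a total function on predicates, but it is constrained, and used,
  -- only on measurable ones.
  record ProbabilitySpace : Set₁ where
    field
      Ω          : Set
      Measurable : Pred (Pred Ω 0ℓ) 0ℓ
      U-measurable : Measurable U
      ∁-measurable : ∀ {E} → Measurable E → Measurable (∁ E)
      ⋃-measurable : ∀ {E : ℕ → Pred Ω 0ℓ} →
                     (∀ n → Measurable (E n)) → Measurable (⋃ ℕ E)
      measurable-resp : ∀ {E F} → E ≐ F → Measurable E → Measurable F
      pr         : Pred Ω 0ℓ → Carrier
      pr-cong    : ∀ {E F} → E ≐ F → Measurable E → pr E ≈ pr F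
      pr-nonNeg  : ∀ {E} → Measurable E → 0# ≤ pr E
      pr-U       : pr U ≈ 1#
      pr-⋃       : ∀ {E : ℕ → Pred Ω 0ℓ} → (∀ n → Measurable (E n)) →
                   (∀ m n → m ≢ n → E m ⊥ E n) →
                   IsLub (λ x → ∃ λ n → x ≈ sum {n} λ i → pr (E (toℕ i)))
                         (pr (⋃ ℕ E))

  -- A randomized algorithm making k non-adaptive matrix-vector queries to a
  -- d × d matrix: the queries depend on the random coins only.
  record NonAdaptiveAlgorithm (d k : ℕ) : Set₁ where
    field
      coins : ProbabilitySpace

    open ProbabilitySpace coins public

    field
      query       : Ω → Fin k → Vec d
      decide      : Ω → (answers : Fin k → Vec d) → Bool
      decide-cong : ∀ ω {a b} → (∀ j → a j ≋ b j) → decide ω a ≡ decide ω b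

    run : Matrix d → Ω → Bool
    run A ω = decide ω λ j → A *ᵥ query ω j

    Outputs : Bool → Matrix d → Pred Ω 0ℓ
    Outputs b A ω = run A ω ≡ b

    field
      outputs-measurable : ∀ b A → Symmetric A → Measurable (Outputs b A)

  2/3 : Carrier
  2/3 = fromℕ 2 * fromℕ 3 ⁻¹

  record IsTester {d k} (ε : Carrier) (p : Exponent)
                  (𝒜 : NonAdaptiveAlgorithm d k) : Set where
    open NonAdaptiveAlgorithm 𝒜
    field
      accepts : ∀ A → PSD A → 2/3 ≤ pr (Outputs true A)
      rejects : ∀ A → Symmetric A → IsFar p ε A → 2/3 ≤ pr (Outputs false A)

  IsOneSided : ∀ {d k} → NonAdaptiveAlgorithm d k → Set
  IsOneSided 𝒜 = ∀ A ω → PSD A → run A ω ≡ true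
    where open NonAdaptiveAlgorithm 𝒜

module Submission where

-- The hard inputs are A = diag(1, …, 1, -λ, 1, …, 1) = I - (1 + λ) eᵢ eᵢᵀ with
-- λ ≈ ε d^(1/p), one for each position i of -λ; each is far from PSD.  Let P
-- project onto the span of the k queries.  If (1 + λ) Pᵢᵢ < 1, then A is positive
-- definite on that span and some PSD matrix answers all queries as A does, so a
-- one-sided tester accepts A.  Since tr P ≤ k, for every outcome of the coins at
-- most (1 + λ) k of the d inputs are rejected, whereas each of them is rejected
-- with probability at least 2/3.  Hence (2/3) d ≤ (1 + λ) k ≤ 2 λ k, where λ ≥ 1
-- because d^(1-1/p) / ε ≤ K d.  (λ is written μ in the code.)

-- The size of λ is forced from two sides. Farness asks for d - 1 + λ^p ≤ (λ/ε)^p. With λ = ε C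
-- d^(1/p) and C ≥ 1 this follows from C (1 - ε) ≥ 1, and since ε ≤ ε₀ < 1 one constant C serves
-- every ε and every p. The step 1 + λ ≤ 2 λ asks for λ ≥ 1, which follows from C ≥ K. Two obstacles
-- shape the rest. A real power is given only as a supremum of rational powers, so the norm estimate
-- avoids the laws of real exponents: each inequality between powers is raised to a natural exponent
-- and compared there. Probability is given only on events, so the expected number of rejections is
-- bounded by splitting events instead of integrating.

open import Defs
open import Algebra.Bundles using (CommutativeRing)
open import Algebra.Solver.Ring.AlmostCommutativeRing
  using (fromCommutativeRing; _-Raw-AlmostCommutative⟶_; Induced-equivalence)
open import Axiom.ExcludedMiddle using (ExcludedMiddle)
open import Data.Bool.Base using (Bool; true; false; if_then_else_)
open import Data.Empty using (⊥-elim)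
open import Data.Fin.Base using (Fin; zero; suc; toℕ)
open import Data.Fin.Properties using (_≟_)
open import Data.Integer.Base as ℤ using (ℤ; +_; -[1+_]; _⊖_)
open import Data.Maybe.Base using (just; nothing)
open import Data.Nat.Base as ℕ using (ℕ; zero; suc; NonZero)
open import Data.Product.Base using (∃; _×_; _,_; proj₁; proj₂)
open import Data.Sum.Base using (inj₁; inj₂; [_,_]′)
open import Data.Unit.Base using (tt)
open import Function.Base using (_∘_; _$_)
open import Level using (0ℓ)
open import Relation.Binary.Bundles using (Poset; TotalOrder)
open import Relation.Binary.Definitions using (WeaklyDecidable)
open import Relation.Binary.PropositionalEquality.Core as ≡ using (_≡_; _≢_)
open import Relation.Binary.Structures using (IsTotalOrder)
open import Relation.Nullary.Decidable.Core using (Dec; yes; no; does; decidable-stable)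
open import Relation.Nullary.Negation.Core using (¬_; contradiction)
open import Relation.Unary using (Pred; _∈_; _≐_; _⊥_; U; ∁; _∩_; ⋃)
import Algebra.Properties.AbelianGroup as AbelianGroupProperties
import Algebra.Properties.CommutativeSemiring.Exp as ExpProperties
import Algebra.Properties.Ring as RingProperties
import Algebra.Properties.Semiring.Mult as MultProperties
import Algebra.Properties.Semiring.Mult.TCOptimised as OptimisedMult
import Algebra.Properties.Semiring.Sum as SumProperties
import Algebra.Solver.Ring as RingSolver
import Data.Integer.Properties as ℤ
import Data.Nat.Properties as ℕ
import Data.Sign.Base as Sign
import Relation.Binary.Reasoning.PartialOrder as PartialOrderReasoning
import Relation.Binary.Reasoning.Setoid as SetoidReasoning

-- A ring solver with integer coefficients.

-- The solver must decide equality of coefficients, hence coefficients in ℤ.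
module IntegerCoefficients (R : CommutativeRing 0ℓ 0ℓ) where
  open CommutativeRing R
  open RingProperties ring
  open AbelianGroupProperties +-abelianGroup using (⁻¹-∙-comm)
  open OptimisedMult semiring renaming (_×_ to _×′_)
  open SetoidReasoning setoid

  private
    -- The optimised multiple makes `⟦ + 0 ⟧` and `⟦ + 1 ⟧` compute to `0#` and `1#`, so that
    -- `con (+ 0)` and `con (+ 1)` match these constants in goals by definition.
    ⟦_⟧ : ℤ → Carrier
    ⟦ + n ⟧      = n ×′ 1#
    ⟦ -[1+ n ] ⟧ = - (suc n ×′ 1#)

    cancel-1# : ∀ x y → (1# + x) - (1# + y) ≈ x - y
    cancel-1# x y = begin
      (1# + x) - (1# + y)    ≈⟨ +-congˡ (⁻¹-∙-comm 1# y) ⟨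
      (1# + x) + (- 1# - y)  ≈⟨ +-congʳ (+-comm 1# x) ⟩
      (x + 1#) + (- 1# - y)  ≈⟨ +-assoc x 1# _ ⟩
      x + (1# + (- 1# - y))  ≈⟨ +-congˡ (+-assoc 1# (- 1#) _) ⟨
      x + ((1# - 1#) - y)    ≈⟨ +-congˡ (+-congʳ (-‿inverseʳ 1#)) ⟩
      x + (0# - y)           ≈⟨ +-congˡ (+-identityˡ _) ⟩
      x - y                  ∎

    ⊖-homo : ∀ m n → ⟦ m ⊖ n ⟧ ≈ m ×′ 1# - n ×′ 1#
    ⊖-homo zero    zero    = sym (-‿inverseʳ 0#)
    ⊖-homo zero    (suc n) = sym (+-identityˡ _)
    ⊖-homo (suc m) zero    = sym (trans (+-congˡ -0#≈0#) (+-identityʳ _))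
    ⊖-homo (suc m) (suc n) = begin
      ⟦ suc m ⊖ suc n ⟧                ≡⟨ ≡.cong ⟦_⟧ (ℤ.[1+m]⊖[1+n]≡m⊖n m n) ⟩
      ⟦ m ⊖ n ⟧                        ≈⟨ ⊖-homo m n ⟩
      m ×′ 1# - n ×′ 1#                ≈⟨ cancel-1# _ _ ⟨
      (1# + m ×′ 1#) - (1# + n ×′ 1#)  ≈⟨ +-cong (1+× m 1#) (-‿cong (1+× n 1#)) ⟨
      suc m ×′ 1# - suc n ×′ 1#        ∎

    ⟦⟧-+ : ∀ i j → ⟦ i ℤ.+ j ⟧ ≈ ⟦ i ⟧ + ⟦ j ⟧
    ⟦⟧-+ (+ m)      (+ n)      = ×-homo-+ 1# m n
    ⟦⟧-+ (+ m)      -[1+ n ]   = ⊖-homo m (suc n)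
    ⟦⟧-+ -[1+ m ]   (+ n)      = trans (⊖-homo n (suc m)) (+-comm _ _)
    ⟦⟧-+ -[1+ m ]   -[1+ n ]   = begin
      - (suc (suc (m ℕ.+ n)) ×′ 1#)  ≡⟨ ≡.cong (λ l → - (suc l ×′ 1#)) (ℕ.+-suc m n) ⟨
      - ((suc m ℕ.+ suc n) ×′ 1#)    ≈⟨ -‿cong (×-homo-+ 1# (suc m) (suc n)) ⟩
      - (suc m ×′ 1# + suc n ×′ 1#)  ≈⟨ ⁻¹-∙-comm _ _ ⟨
      - (suc m ×′ 1#) - suc n ×′ 1#  ∎

    ⟦⟧-neg : ∀ i → ⟦ ℤ.- i ⟧ ≈ - ⟦ i ⟧
    ⟦⟧-neg (+ zero)  = sym -0#≈0#
    ⟦⟧-neg (+ suc n) = refl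
    ⟦⟧-neg -[1+ n ]  = sym (-‿involutive _)

    ⟦-◃⟧ : ∀ n → ⟦ Sign.- ℤ.◃ n ⟧ ≈ - (n ×′ 1#)
    ⟦-◃⟧ zero    = sym -0#≈0#
    ⟦-◃⟧ (suc n) = refl

    ⟦+◃⟧ : ∀ n → ⟦ Sign.+ ℤ.◃ n ⟧ ≈ n ×′ 1#
    ⟦+◃⟧ zero    = refl
    ⟦+◃⟧ (suc n) = refl

    ⟦⟧-* : ∀ i j → ⟦ i ℤ.* j ⟧ ≈ ⟦ i ⟧ * ⟦ j ⟧
    ⟦⟧-* (+ m)    (+ n)    = trans (⟦+◃⟧ (m ℕ.* n)) (×1-homo-* m n)
    ⟦⟧-* (+ m)    -[1+ n ] = begin
      ⟦ Sign.- ℤ.◃ m ℕ.* suc n ⟧   ≈⟨ ⟦-◃⟧ (m ℕ.* suc n) ⟩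
      - ((m ℕ.* suc n) ×′ 1#)      ≈⟨ -‿cong (×1-homo-* m (suc n)) ⟩
      - (m ×′ 1# * (suc n ×′ 1#))  ≈⟨ -‿distribʳ-* _ _ ⟩
      m ×′ 1# * - (suc n ×′ 1#)    ∎
    ⟦⟧-* -[1+ m ] (+ n)    = begin
      ⟦ Sign.- ℤ.◃ suc m ℕ.* n ⟧   ≈⟨ ⟦-◃⟧ (suc m ℕ.* n) ⟩
      - ((suc m ℕ.* n) ×′ 1#)      ≈⟨ -‿cong (×1-homo-* (suc m) n) ⟩
      - (suc m ×′ 1# * (n ×′ 1#))  ≈⟨ -‿distribˡ-* _ _ ⟩
      - (suc m ×′ 1#) * (n ×′ 1#)  ∎
    ⟦⟧-* -[1+ m ] -[1+ n ] = begin
      (suc m ℕ.* suc n) ×′ 1#            ≈⟨ ×1-homo-* (suc m) (suc n) ⟩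
      suc m ×′ 1# * (suc n ×′ 1#)        ≈⟨ -‿involutive _ ⟨
      - - (suc m ×′ 1# * (suc n ×′ 1#))  ≈⟨ -‿cong (-‿distribʳ-* _ _) ⟩
      - (suc m ×′ 1# * - (suc n ×′ 1#))  ≈⟨ -‿distribˡ-* _ _ ⟩
      - (suc m ×′ 1#) * - (suc n ×′ 1#)  ∎

    morphism : ℤ.+-*-rawRing -Raw-AlmostCommutative⟶ fromCommutativeRing R
    morphism = record
      { ⟦_⟧    = ⟦_⟧
      ; +-homo = ⟦⟧-+
      ; *-homo = ⟦⟧-*
      ; -‿homo = ⟦⟧-neg
      ; 0-homo = refl
      ; 1-homo = refl
      }

    _coeff≟_ : WeaklyDecidable (Induced-equivalence morphism)
    i coeff≟ j with i ℤ.≟ j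
    ... | yes i≡j = just (reflexive (≡.cong ⟦_⟧ i≡j))
    ... | no  _   = nothing

  open RingSolver ℤ.+-*-rawRing (fromCommutativeRing R) morphism _coeff≟_ public

-- Arithmetic of ordered fields, natural numbers and natural powers.

module OrderedField (em : ExcludedMiddle 0ℓ) (ℝ : CompleteOrderedField) where
  open CompleteOrderedField ℝ public renaming (zero to *-zero)
  open Reals ℝ public
  open ExpProperties commutativeSemiring public using (^-congˡ; ^-homo-*; ^-assocʳ; ^-distrib-*)
  open RingProperties ring public
  open MultProperties semiring public using (×1-homo-*; ×-homo-+)
  open SumProperties semiring public
    using (sum-cong-≋; sum-replicate; sum-replicate-zero; ∑-distrib-+; ∑-comm; *-distribˡ-sum; *-distribʳ-sum)
  open IntegerCoefficients commutativeRing public using (solve; _:=_; _:+_; _:*_; _:-_; :-_; con)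
  open IsTotalOrder isTotalOrder public using (total; antisym)
    renaming (refl to ≤-refl; reflexive to ≤-reflexive; trans to ≤-trans)

  poset : Poset 0ℓ 0ℓ 0ℓ
  poset = TotalOrder.poset (record { isTotalOrder = isTotalOrder })

  open PartialOrderReasoning poset public

  private
    variable
      a x y z w : Carrier

  ≰⇒≥ : ¬ x ≤ y → y ≤ x
  ≰⇒≥ {x} {y} x≰y = [ (λ x≤y → contradiction x≤y x≰y) , (λ y≤x → y≤x) ]′ (total x y)

  +-monoʳ-≤ : ∀ z → x ≤ y → z + x ≤ z + y
  +-monoʳ-≤ {x} {y} z x≤y = begin
    z + x  ≈⟨ +-comm z x ⟩
    x + z  ≤⟨ +-monoˡ-≤ z x≤y ⟩
    y + z  ≈⟨ +-comm y z ⟩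
    z + y  ∎

  +-mono-≤ : x ≤ y → z ≤ w → x + z ≤ y + w
  +-mono-≤ {y = y} {z} x≤y z≤w = ≤-trans (+-monoˡ-≤ z x≤y) (+-monoʳ-≤ y z≤w)

  x≤y⇒0≤y-x : x ≤ y → 0# ≤ y - x
  x≤y⇒0≤y-x {x} {y} x≤y = begin
    0#     ≈⟨ -‿inverseʳ x ⟨
    x - x  ≤⟨ +-monoˡ-≤ (- x) x≤y ⟩
    y - x  ∎

  0≤y-x⇒x≤y : 0# ≤ y - x → x ≤ y
  0≤y-x⇒x≤y {y} {x} 0≤y-x = begin
    x            ≈⟨ +-identityˡ x ⟨
    0# + x       ≤⟨ +-monoˡ-≤ x 0≤y-x ⟩
    (y - x) + x  ≈⟨ solve 2 (λ y x → (y :- x) :+ x := y) refl y x ⟩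
    y            ∎

  x≤x+y : 0# ≤ y → x ≤ x + y
  x≤x+y {y} {x} 0≤y = ≤-trans (≤-reflexive (sym (+-identityʳ x))) (+-monoʳ-≤ x 0≤y)

  +-nonNeg : 0# ≤ x → 0# ≤ y → 0# ≤ x + y
  +-nonNeg 0≤x 0≤y = ≤-trans 0≤x (x≤x+y 0≤y)

  neg-mono-≤ : x ≤ y → - y ≤ - x
  neg-mono-≤ {x} {y} x≤y = 0≤y-x⇒x≤y $ begin
    0#         ≤⟨ x≤y⇒0≤y-x x≤y ⟩
    y - x      ≈⟨ solve 2 (λ y x → y :- x := :- x :- (:- y)) refl y x ⟩
    - x - - y  ∎

  +-cancelʳ-≤ : ∀ z → x + z ≤ y + z → x ≤ y
  +-cancelʳ-≤ {x} {y} z x+z≤y+z = 0≤y-x⇒x≤y $ begin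
    0#                 ≤⟨ x≤y⇒0≤y-x x+z≤y+z ⟩
    (y + z) - (x + z)  ≈⟨ solve 3 (λ x y z → (y :+ z) :- (x :+ z) := y :- x) refl x y z ⟩
    y - x              ∎

  *-monoˡ-≤ : 0# ≤ x → y ≤ z → x * y ≤ x * z
  *-monoˡ-≤ {x} {y} {z} 0≤x y≤z = 0≤y-x⇒x≤y $ begin
    0#             ≤⟨ *-nonNeg 0≤x (x≤y⇒0≤y-x y≤z) ⟩
    x * (z - y)    ≈⟨ solve 3 (λ x y z → x :* (z :- y) := x :* z :- x :* y) refl x y z ⟩
    x * z - x * y  ∎

  *-monoʳ-≤ : 0# ≤ x → y ≤ z → y * x ≤ z * x
  *-monoʳ-≤ {x} {y} {z} 0≤x y≤z = begin
    y * x  ≈⟨ *-comm y x ⟩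
    x * y  ≤⟨ *-monoˡ-≤ 0≤x y≤z ⟩
    x * z  ≈⟨ *-comm x z ⟩
    z * x  ∎

  *-mono-≤ : 0# ≤ x → 0# ≤ z → x ≤ y → z ≤ w → x * z ≤ y * w
  *-mono-≤ 0≤x 0≤z x≤y z≤w = ≤-trans (*-monoʳ-≤ 0≤z x≤y) (*-monoˡ-≤ (≤-trans 0≤x x≤y) z≤w)

  0≤x*x : ∀ x → 0# ≤ x * x
  0≤x*x x with total 0# x
  ... | inj₁ 0≤x = *-nonNeg 0≤x 0≤x
  ... | inj₂ x≤0 = begin
    0#         ≤⟨ *-nonNeg 0≤-x 0≤-x ⟩
    - x * - x  ≈⟨ solve 1 (λ x → :- x :* :- x := x :* x) refl x ⟩
    x * x      ∎
    where
    0≤-x : 0# ≤ - x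
    0≤-x = ≤-trans (≤-reflexive (sym -0#≈0#)) (neg-mono-≤ x≤0)

  0≤1 : 0# ≤ 1#
  0≤1 = ≤-trans (0≤x*x 1#) (≤-reflexive (*-identityʳ 1#))

  0<1 : 0# < 1#
  0<1 = 0≤1 , 1≉0 ∘ sym

  x<x+1 : ∀ x → ¬ x + 1# ≤ x
  x<x+1 x x+1≤x = 1≉0 (antisym 1≤0 0≤1)
    where
    1≤0 : 1# ≤ 0#
    1≤0 = +-cancelʳ-≤ x $ begin
      1# + x  ≈⟨ +-comm 1# x ⟩
      x + 1#  ≤⟨ x+1≤x ⟩
      x       ≈⟨ +-identityˡ x ⟨
      0# + x  ∎

  1≤x⇒0≤x : 1# ≤ x → 0# ≤ x
  1≤x⇒0≤x = ≤-trans 0≤1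

  <-≤-trans : x < y → y ≤ z → x < z
  <-≤-trans (x≤y , x≉y) y≤z = ≤-trans x≤y y≤z , λ x≈z → x≉y (antisym x≤y (≤-trans y≤z (≤-reflexive (sym x≈z))))

  1≤x⇒0<x : 1# ≤ x → 0# < x
  1≤x⇒0<x = <-≤-trans 0<1

  ⁻¹-inverse : 0# < x → x * x ⁻¹ ≈ 1#
  ⁻¹-inverse {x} (_ , 0≉x) = ⁻¹-inverseʳ x (0≉x ∘ sym)

  -- Totality leaves only the case `z ≤ y`, where both products are equal and the inverse can be
  -- applied to an equation. Multiplying the inequality by `x ⁻¹` would need the sign of `x ⁻¹`,
  -- which is itself derived from this lemma.
  *-cancelˡ-≤ : 0# < x → x * y ≤ x * z → y ≤ z
  *-cancelˡ-≤ {x} {y} {z} 0<x xy≤xz with total y z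
  ... | inj₁ y≤z = y≤z
  ... | inj₂ z≤y = ≤-reflexive $ begin-equality
    y               ≈⟨ undo y ⟩
    x ⁻¹ * (x * y)  ≈⟨ *-congˡ (antisym xy≤xz (*-monoˡ-≤ (proj₁ 0<x) z≤y)) ⟩
    x ⁻¹ * (x * z)  ≈⟨ undo z ⟨
    z               ∎
    where
    undo : ∀ u → u ≈ x ⁻¹ * (x * u)
    undo u = begin-equality
      u               ≈⟨ *-identityˡ u ⟨
      1# * u          ≈⟨ *-congʳ (⁻¹-inverse 0<x) ⟨
      (x * x ⁻¹) * u  ≈⟨ solve 3 (λ x y u → x :* y :* u := y :* (x :* u)) refl x (x ⁻¹) u ⟩
      x ⁻¹ * (x * u)  ∎

  ⁻¹-nonNeg : 0# < x → 0# ≤ x ⁻¹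
  ⁻¹-nonNeg {x} 0<x = *-cancelˡ-≤ 0<x $ begin
    x * 0#    ≈⟨ zeroʳ x ⟩
    0#        ≤⟨ 0≤1 ⟩
    1#        ≈⟨ ⁻¹-inverse 0<x ⟨
    x * x ⁻¹  ∎

  ⁻¹-pos : 0# < x → 0# < x ⁻¹
  ⁻¹-pos {x} 0<x = ⁻¹-nonNeg 0<x , λ 0≈x⁻¹ → 1≉0 $ begin-equality
    1#        ≈⟨ ⁻¹-inverse 0<x ⟨
    x * x ⁻¹  ≈⟨ *-congˡ 0≈x⁻¹ ⟨
    x * 0#    ≈⟨ zeroʳ x ⟩
    0#        ∎

  *-pos : 0# < x → 0# < y → 0# < x * y
  *-pos {x} {y} 0<x (0≤y , 0≉y) = *-nonNeg (proj₁ 0<x) 0≤y , λ 0≈xy → 0≉y $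
    antisym 0≤y $ *-cancelˡ-≤ 0<x $ ≤-reflexive (trans (sym 0≈xy) (sym (zeroʳ x)))

  ⁻¹-≤1 : 1# ≤ x → x ⁻¹ ≤ 1#
  ⁻¹-≤1 {x} 1≤x = *-cancelˡ-≤ 0<x $ begin
    x * x ⁻¹  ≈⟨ ⁻¹-inverse 0<x ⟩
    1#        ≤⟨ 1≤x ⟩
    x         ≈⟨ *-identityʳ x ⟨
    x * 1#    ∎
    where 0<x = 1≤x⇒0<x 1≤x

  sum-mono-≤ : ∀ {n} {u v : Vec n} → (∀ i → u i ≤ v i) → sum u ≤ sum v
  sum-mono-≤ {zero}  u≤v = ≤-refl
  sum-mono-≤ {suc n} u≤v = +-mono-≤ (u≤v zero) (sum-mono-≤ (u≤v ∘ suc))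

  sum-nonNeg : ∀ {n} {u : Vec n} → (∀ i → 0# ≤ u i) → 0# ≤ sum u
  sum-nonNeg {zero}  0≤u = ≤-refl
  sum-nonNeg {suc n} 0≤u = +-nonNeg (0≤u zero) (sum-nonNeg (0≤u ∘ suc))

  ≤-sum : ∀ {n} {u : Vec n} → (∀ i → 0# ≤ u i) → ∀ i → u i ≤ sum u
  ≤-sum 0≤u zero    = x≤x+y (sum-nonNeg (0≤u ∘ suc))
  ≤-sum 0≤u (suc i) = ≤-trans (≤-sum (0≤u ∘ suc) i) $
    ≤-trans (x≤x+y (0≤u zero)) (≤-reflexive (+-comm _ _))

  fromℕ-nonNeg : ∀ n → 0# ≤ fromℕ n
  fromℕ-nonNeg zero    = ≤-refl
  fromℕ-nonNeg (suc n) = +-nonNeg 0≤1 (fromℕ-nonNeg n)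

  fromℕ-1 : fromℕ 1 ≈ 1#
  fromℕ-1 = +-identityʳ 1#

  1≤fromℕ : ∀ n .{{_ : NonZero n}} → 1# ≤ fromℕ n
  1≤fromℕ (suc n) = x≤x+y (fromℕ-nonNeg n)

  fromℕ-pos : ∀ n .{{_ : NonZero n}} → 0# < fromℕ n
  fromℕ-pos n = 1≤x⇒0<x (1≤fromℕ n)

  fromℕ-mono-≤ : ∀ {m n} → m ℕ.≤ n → fromℕ m ≤ fromℕ n
  fromℕ-mono-≤ {n = n} ℕ.z≤n       = fromℕ-nonNeg n
  fromℕ-mono-≤         (ℕ.s≤s m≤n) = +-monoʳ-≤ 1# (fromℕ-mono-≤ m≤n)

  fromℕ-cancel-≤ : ∀ m n → fromℕ m ≤ fromℕ n → m ℕ.≤ n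
  fromℕ-cancel-≤ m n m≤n with m ℕ.≤? n
  ... | yes p = p
  ... | no ¬p = ⊥-elim $ x<x+1 (fromℕ n) $ begin
    fromℕ n + 1#   ≈⟨ +-comm _ _ ⟩
    fromℕ (suc n)  ≤⟨ fromℕ-mono-≤ (ℕ.≰⇒> ¬p) ⟩
    fromℕ m        ≤⟨ m≤n ⟩
    fromℕ n        ∎

  -- If the naturals were bounded, their supremum minus one would bound them as well.
  archimedean : ∀ x → ∃ λ n → x ≤ fromℕ n
  archimedean x with em {∃ λ n → x ≤ fromℕ n}
  ... | yes bounded = bounded
  ... | no unbounded = ⊥-elim (x<x+1 (s - 1#) (≤-trans (≤-reflexive s-1+1≈s) s≤s-1))
    where
    Naturals : Pred Carrier 0ℓ
    Naturals y = ∃ λ n → y ≈ fromℕ n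

    lub : ∃ (IsLub Naturals)
    lub = complete Naturals (0# , 0 , refl)
      (x , λ { y (n , y≈n) → ≤-trans (≤-reflexive y≈n) (≰⇒≥ (unbounded ∘ (n ,_))) })

    s = proj₁ lub

    s-1+1≈s : (s - 1#) + 1# ≈ s
    s-1+1≈s = solve 1 (λ s → (s :- con (+ 1)) :+ con (+ 1) := s) refl s

    s≤s-1 : s ≤ s - 1#
    s≤s-1 = proj₂ (proj₂ lub) (s - 1#) λ { y (n , y≈n) → +-cancelʳ-≤ 1# $ begin
      y + 1#         ≈⟨ +-congʳ y≈n ⟩
      fromℕ n + 1#   ≈⟨ +-comm _ _ ⟩
      fromℕ (suc n)  ≤⟨ proj₁ (proj₂ lub) _ (suc n , refl) ⟩
      s              ≈⟨ s-1+1≈s ⟨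
      (s - 1#) + 1#  ∎ }

  ^-nonNeg : ∀ n → 0# ≤ x → 0# ≤ x ^ n
  ^-nonNeg zero    0≤x = 0≤1
  ^-nonNeg (suc n) 0≤x = *-nonNeg 0≤x (^-nonNeg n 0≤x)

  ^-pos : ∀ n → 0# < x → 0# < x ^ n
  ^-pos zero    0<x = 0<1
  ^-pos (suc n) 0<x = *-pos 0<x (^-pos n 0<x)

  ^-monoˡ-≤ : ∀ n → 0# ≤ x → x ≤ y → x ^ n ≤ y ^ n
  ^-monoˡ-≤ zero    0≤x x≤y = ≤-refl
  ^-monoˡ-≤ (suc n) 0≤x x≤y = *-mono-≤ 0≤x (^-nonNeg n 0≤x) x≤y (^-monoˡ-≤ n 0≤x x≤y)

  1^n≈1 : ∀ n → 1# ^ n ≈ 1#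
  1^n≈1 zero    = refl
  1^n≈1 (suc n) = trans (*-identityˡ _) (1^n≈1 n)

  1≤x^n : ∀ n → 1# ≤ x → 1# ≤ x ^ n
  1≤x^n n 1≤x = ≤-trans (≤-reflexive (sym (1^n≈1 n))) (^-monoˡ-≤ n 0≤1 1≤x)

  ^-monoʳ-≤ : 1# ≤ x → ∀ {m n} → m ℕ.≤ n → x ^ m ≤ x ^ n
  ^-monoʳ-≤ 1≤x {n = n} ℕ.z≤n       = 1≤x^n n 1≤x
  ^-monoʳ-≤ 1≤x         (ℕ.s≤s m≤n) = *-monoˡ-≤ (1≤x⇒0≤x 1≤x) (^-monoʳ-≤ 1≤x m≤n)

  ^-≤1 : ∀ n → 0# ≤ x → x ≤ 1# → x ^ n ≤ 1#
  ^-≤1 n 0≤x x≤1 = ≤-trans (^-monoˡ-≤ n 0≤x x≤1) (≤-reflexive (1^n≈1 n))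

  ^-antiʳ-≤ : 0# ≤ x → x ≤ 1# → ∀ {m n} → m ℕ.≤ n → x ^ n ≤ x ^ m
  ^-antiʳ-≤ 0≤x x≤1 {n = n} ℕ.z≤n       = ^-≤1 n 0≤x x≤1
  ^-antiʳ-≤ 0≤x x≤1         (ℕ.s≤s m≤n) = *-monoˡ-≤ 0≤x (^-antiʳ-≤ 0≤x x≤1 m≤n)

  ^-cancelˡ-≤ : ∀ n .{{_ : NonZero n}} → 0# ≤ x → 0# ≤ y → x ^ n ≤ y ^ n → x ≤ y
  ^-cancelˡ-≤ {x} {y} (suc n) 0≤x 0≤y xⁿ≤yⁿ with total x y | em {0# ≈ x}
  ... | inj₁ x≤y | _       = x≤y
  ... | inj₂ y≤x | yes 0≈x = ≤-trans (≤-reflexive (sym 0≈x)) 0≤y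
  ... | inj₂ y≤x | no 0≉x  = *-cancelˡ-≤ (^-pos n (0≤x , 0≉x)) $ begin
    x ^ n * x  ≈⟨ *-comm _ _ ⟩
    x * x ^ n  ≤⟨ xⁿ≤yⁿ ⟩
    y * y ^ n  ≤⟨ *-monoˡ-≤ 0≤y (^-monoˡ-≤ n 0≤y y≤x) ⟩
    y * x ^ n  ≈⟨ *-comm _ _ ⟩
    x ^ n * y  ∎

  ^-swap : ∀ x m n → (x ^ m) ^ n ≈ (x ^ n) ^ m
  ^-swap x m n = begin-equality
    (x ^ m) ^ n    ≈⟨ ^-assocʳ x m n ⟩
    x ^ (m ℕ.* n)  ≡⟨ ≡.cong (x ^_) (ℕ.*-comm m n) ⟩
    x ^ (n ℕ.* m)  ≈⟨ ^-assocʳ x n m ⟨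
    (x ^ n) ^ m    ∎

-- Real powers as suprema of rational powers.

module RealPowers (em : ExcludedMiddle 0ℓ) (ℝ : CompleteOrderedField) where
  open OrderedField em ℝ

  private
    variable
      a x y z w : Carrier

  -- For positive `y` the bound `y ⁻¹ * X` on `S` passes to the supremum. For `y ≈ 0#` there is
  -- nothing to divide by, and the claim is `0# ≤ X`.
  lub-* : ∀ {S s X} → ∃ S → IsLub S s → 0# ≤ y → 0# ≤ X →
          (∀ z → z ∈ S → y * z ≤ X) → y * s ≤ X
  lub-* {y} {S} {s} {X} (z₀ , z₀∈S) (_ , least) 0≤y 0≤X yz≤X with em {0# ≈ y}
  ... | yes 0≈y = begin
    y * s   ≈⟨ *-congʳ 0≈y ⟨
    0# * s  ≈⟨ zeroˡ s ⟩
    0#      ≤⟨ 0≤X ⟩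
    X       ∎
  ... | no 0≉y = begin
    y * s           ≤⟨ *-monoˡ-≤ 0≤y (least (y ⁻¹ * X) bound) ⟩
    y * (y ⁻¹ * X)  ≈⟨ cancel ⟩
    X               ∎
    where
    0<y : 0# < y
    0<y = 0≤y , 0≉y

    cancel : y * (y ⁻¹ * X) ≈ X
    cancel = trans (sym (*-assoc _ _ _)) (trans (*-congʳ (⁻¹-inverse 0<y)) (*-identityˡ X))

    bound : IsUpperBound S (y ⁻¹ * X)
    bound z z∈S = *-cancelˡ-≤ 0<y (≤-trans (yz≤X z z∈S) (≤-reflexive (sym cancel)))

  -- Powers commute with suprema.  The factor y absorbs, one at a time, the
  -- copies of z that have already been replaced by s.
  lub-^ : ∀ {S s X} → ∃ S → (∀ z → z ∈ S → 0# ≤ z) → IsLub S s → 0# ≤ X →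
          ∀ n {y} → 0# ≤ y → (∀ z → z ∈ S → y * z ^ n ≤ X) → y * s ^ n ≤ X
  lub-^ (z , z∈S) S≥0 lub 0≤X zero 0≤y yzⁿ≤X = yzⁿ≤X z z∈S
  lub-^ {S} {s} {X} nonempty@(z₀ , z₀∈S) S≥0 lub 0≤X (suc n) {y} 0≤y yzⁿ≤X = begin
    y * (s * s ^ n)  ≈⟨ *-assoc y s _ ⟨
    (y * s) * s ^ n  ≤⟨ lub-^ nonempty S≥0 lub 0≤X n (*-nonNeg 0≤y 0≤s) absorb ⟩
    X                ∎
    where
    0≤s : 0# ≤ s
    0≤s = ≤-trans (S≥0 z₀ z₀∈S) (proj₁ lub z₀ z₀∈S)

    -- Replacing the smaller of `z` and `w` by the larger one turns the mixed product into a pure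
    -- power of one member of `S`.
    mixed : ∀ z → z ∈ S → ∀ w → w ∈ S → (y * z ^ n) * w ≤ X
    mixed z z∈S w w∈S with total z w
    ... | inj₁ z≤w = begin
      (y * z ^ n) * w  ≈⟨ trans (*-assoc _ _ _) (*-congˡ (*-comm _ _)) ⟩
      y * (w * z ^ n)  ≤⟨ *-monoˡ-≤ 0≤y (*-monoˡ-≤ (S≥0 w w∈S) (^-monoˡ-≤ n (S≥0 z z∈S) z≤w)) ⟩
      y * w ^ suc n    ≤⟨ yzⁿ≤X w w∈S ⟩
      X                ∎
    ... | inj₂ w≤z = begin
      (y * z ^ n) * w  ≈⟨ trans (*-assoc _ _ _) (*-congˡ (*-comm _ _)) ⟩
      y * (w * z ^ n)  ≤⟨ *-monoˡ-≤ 0≤y (*-monoʳ-≤ (^-nonNeg n (S≥0 z z∈S)) w≤z) ⟩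
      y * z ^ suc n    ≤⟨ yzⁿ≤X z z∈S ⟩
      X                ∎

    absorb : ∀ z → z ∈ S → (y * s) * z ^ n ≤ X
    absorb z z∈S = begin
      (y * s) * z ^ n  ≈⟨ trans (*-assoc _ _ _) (trans (*-congˡ (*-comm _ _)) (sym (*-assoc _ _ _))) ⟩
      (y * z ^ n) * s  ≤⟨ lub-* nonempty lub (*-nonNeg 0≤y (^-nonNeg n (S≥0 z z∈S))) 0≤X (mixed z z∈S) ⟩
      X                ∎

  1∈RationalPowers : 0# ≤ a → 1# ∈ RationalPowers x a
  1∈RationalPowers 0≤a = 0 , 0 , *-nonNeg 0≤a (fromℕ-nonNeg 1) , 0≤1 , 1^n≈1 1

  -- Raised to the power `suc n`, both sides become natural powers of `x`, with exponents `m * q`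
  -- and `r * suc n`. These compare because m / (n + 1) ≤ `a` ≤ r / q when `q` is positive.
  rationalPower-≤ : ∀ q r → 1# ≤ x → a * fromℕ q ≤ fromℕ r →
                    z ∈ RationalPowers x a → z ^ q ≤ x ^ r
  rationalPower-≤ {x} {a} {z} q r 1≤x aq≤r (m , n , m≤a[1+n] , 0≤z , zⁿ≈xᵐ) =
    ^-cancelˡ-≤ (suc n) (^-nonNeg q 0≤z) (^-nonNeg r (1≤x⇒0≤x 1≤x)) $ begin
    (z ^ q) ^ suc n    ≈⟨ ^-swap z q (suc n) ⟩
    (z ^ suc n) ^ q    ≈⟨ ^-congˡ q zⁿ≈xᵐ ⟩
    (x ^ m) ^ q        ≈⟨ ^-assocʳ x m q ⟩
    x ^ (m ℕ.* q)      ≤⟨ ^-monoʳ-≤ 1≤x (fromℕ-cancel-≤ (m ℕ.* q) (r ℕ.* suc n) mq≤r[1+n]) ⟩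
    x ^ (r ℕ.* suc n)  ≈⟨ ^-assocʳ x r (suc n) ⟨
    (x ^ r) ^ suc n    ∎
    where
    mq≤r[1+n] : fromℕ (m ℕ.* q) ≤ fromℕ (r ℕ.* suc n)
    mq≤r[1+n] = begin
      fromℕ (m ℕ.* q)              ≈⟨ ×1-homo-* m q ⟩
      fromℕ m * fromℕ q            ≤⟨ *-monoʳ-≤ (fromℕ-nonNeg q) m≤a[1+n] ⟩
      a * fromℕ (suc n) * fromℕ q  ≈⟨ solve 3 (λ a n q → a :* n :* q := a :* q :* n) refl a _ _ ⟩
      a * fromℕ q * fromℕ (suc n)  ≤⟨ *-monoʳ-≤ (fromℕ-nonNeg (suc n)) aq≤r ⟩
      fromℕ r * fromℕ (suc n)      ≈⟨ ×1-homo-* r (suc n) ⟨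
      fromℕ (r ℕ.* suc n)          ∎

  -- This replaces the laws of real exponents: a rational upper bound r / q on `a` becomes an
  -- inequality between natural powers of `y` and `x`. It is applied to `D` and to the p-th power of
  -- λ.
  power-≤ : ∀ q r → 1# ≤ x → 0# ≤ a → IsLub (RationalPowers x a) y →
            a * fromℕ q ≤ fromℕ r → y ^ q ≤ x ^ r
  power-≤ {x} {a} {y} q r 1≤x 0≤a lub aq≤r = begin
    y ^ q       ≈⟨ *-identityˡ _ ⟨
    1# * y ^ q  ≤⟨ lub-^ (1# , 1∈RationalPowers 0≤a) (λ { _ (_ , _ , _ , 0≤z , _) → 0≤z }) lub
                     (^-nonNeg r (1≤x⇒0≤x 1≤x)) q 0≤1
                     (λ z z∈ → ≤-trans (≤-reflexive (*-identityˡ _)) (rationalPower-≤ q r 1≤x aq≤r z∈)) ⟩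
    x ^ r       ∎

  1≤power : 0# ≤ a → IsLub (RationalPowers x a) y → 1# ≤ y
  1≤power 0≤a (upper , _) = upper 1# (1∈RationalPowers 0≤a)

  -- Farness demands an actual norm, so the powers in it must be shown to exist. A natural number
  -- above `a` bounds all the rational powers.
  power : 1# ≤ x → 0# ≤ a → ∃ (IsLub (RationalPowers x a))
  power {x} {a} 1≤x 0≤a with archimedean a
  ... | N , a≤N = complete _ (1# , 1∈RationalPowers 0≤a) $ x ^ N , λ z z∈ → begin
    z      ≈⟨ *-identityʳ z ⟨
    z ^ 1  ≤⟨ rationalPower-≤ 1 N 1≤x (≤-trans (≤-reflexive (trans (*-congˡ fromℕ-1) (*-identityʳ a))) a≤N) z∈ ⟩
    x ^ N  ∎

  IsPow⇒lub : 1# ≤ x → IsPow x a y → 0# ≤ a × IsLub (RationalPowers x a) y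
  IsPow⇒lub 1≤x (base≥1 _ 0≤a lub)          = 0≤a , lub
  IsPow⇒lub 1≤x (base<1 _ _ (x≤1 , x≉1) _ _ _) = contradiction (antisym x≤1 1≤x) x≉1
  IsPow⇒lub 1≤x (base≈0 x≈0 _ _)            = contradiction (sym x≈0) (proj₂ (1≤x⇒0<x 1≤x))

  -- With E = d^(1/p) and λ = ε C E, this is (d - 1 + λᵖ)^(1/p) ≤ λ / ε.
  module _ {p ε C D E : Carrier} {d : ℕ} .{{_ : NonZero d}} where
    schatten-≤ : 1# ≤ p → 0# < ε → ε ≤ 1# → 1# ≤ C → 1# + C * ε ≤ C →
      IsLub (RationalPowers (fromℕ d) (1# - p ⁻¹)) D → E * D ≈ fromℕ d → 0# ≤ E →
      1# ≤ ε * (C * E) →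
      ∀ {τ} → IsLub (RationalPowers (ε * (C * E)) p) τ →
      ∀ {Y s} → Y + 1# ≈ fromℕ d + τ → IsLub (RationalPowers Y (p ⁻¹)) s →
      s ≤ C * E
    schatten-≤ 1≤p 0<ε ε≤1 1≤C 1+Cε≤C lubD ED≈d 0≤E 1≤λ {τ} lubτ {Y} {s} Y+1≈d+τ (_ , s-least) =
      s-least G λ { z (m , n , m≤[1+n]/p , 0≤z , zⁿ≈Yᵐ) → bound m n z m≤[1+n]/p 0≤z zⁿ≈Yᵐ }
      where
      G = C * E

      0<p : 0# < p
      0<p = 1≤x⇒0<x 1≤p

      0≤p⁻¹ : 0# ≤ p ⁻¹
      0≤p⁻¹ = ⁻¹-nonNeg 0<p

      1≤d : 1# ≤ fromℕ d
      1≤d = 1≤fromℕ d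

      0≤C : 0# ≤ C
      0≤C = 1≤x⇒0≤x 1≤C

      0≤G : 0# ≤ G
      0≤G = *-nonNeg 0≤C 0≤E

      0≤ε : 0# ≤ ε
      0≤ε = proj₁ 0<ε

      1≤G : 1# ≤ G
      1≤G = begin
        1#      ≤⟨ 1≤λ ⟩
        ε * G   ≤⟨ *-monoʳ-≤ 0≤G ε≤1 ⟩
        1# * G  ≈⟨ *-identityˡ G ⟩
        G       ∎

      0≤1-p⁻¹ : 0# ≤ 1# - p ⁻¹
      0≤1-p⁻¹ = x≤y⇒0≤y-x (⁻¹-≤1 1≤p)

      0≤τ : 0# ≤ τ
      0≤τ = 1≤x⇒0≤x (1≤power (proj₁ 0<p) lubτ)

      0≤Y : 0# ≤ Y
      0≤Y = +-cancelʳ-≤ 1# $ begin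
        0# + 1#      ≈⟨ +-comm 0# 1# ⟩
        1# + 0#      ≤⟨ +-mono-≤ 1≤d 0≤τ ⟩
        fromℕ d + τ  ≈⟨ Y+1≈d+τ ⟨
        Y + 1#       ∎

      -- This says m / n ≤ 1 / p implies d^(m/n) ≤ `E`, but `E` is known only through
      -- `E * D ≈ fromℕ d`. Multiplying by d^(n - m) leaves a bound on `D ^ n`, which holds because
      -- (1 - 1/p) n ≤ n - m.
      d^m≤E^n : ∀ m n → m ℕ.≤ n → fromℕ m ≤ p ⁻¹ * fromℕ n → fromℕ d ^ m ≤ E ^ n
      d^m≤E^n m n m≤n m≤n/p = *-cancelˡ-≤ (^-pos (n ℕ.∸ m) (1≤x⇒0<x 1≤d)) $ begin
        fromℕ d ^ (n ℕ.∸ m) * fromℕ d ^ m  ≈⟨ ^-homo-* (fromℕ d) (n ℕ.∸ m) m ⟨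
        fromℕ d ^ (n ℕ.∸ m ℕ.+ m)          ≡⟨ ≡.cong (fromℕ d ^_) (ℕ.m∸n+n≡m m≤n) ⟩
        fromℕ d ^ n                        ≈⟨ ^-congˡ n ED≈d ⟨
        (E * D) ^ n                        ≈⟨ ^-distrib-* E D n ⟩
        E ^ n * D ^ n                      ≤⟨ *-monoˡ-≤ (^-nonNeg n 0≤E)
                                                (power-≤ n (n ℕ.∸ m) 1≤d 0≤1-p⁻¹ lubD exponent) ⟩
        E ^ n * fromℕ d ^ (n ℕ.∸ m)        ≈⟨ *-comm _ _ ⟩
        fromℕ d ^ (n ℕ.∸ m) * E ^ n        ∎
        where
        exponent : (1# - p ⁻¹) * fromℕ n ≤ fromℕ (n ℕ.∸ m)
        exponent = +-cancelʳ-≤ (p ⁻¹ * fromℕ n) $ begin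
          (1# - p ⁻¹) * fromℕ n + p ⁻¹ * fromℕ n
            ≈⟨ solve 2 (λ q n → (con (+ 1) :- q) :* n :+ q :* n := n) refl (p ⁻¹) (fromℕ n) ⟩
          fromℕ n                                 ≡⟨ ≡.cong fromℕ (ℕ.m∸n+n≡m m≤n) ⟨
          fromℕ (n ℕ.∸ m ℕ.+ m)                   ≈⟨ ×-homo-+ 1# (n ℕ.∸ m) m ⟩
          fromℕ (n ℕ.∸ m) + fromℕ m               ≤⟨ +-monoʳ-≤ _ m≤n/p ⟩
          fromℕ (n ℕ.∸ m) + p ⁻¹ * fromℕ n        ∎

      bound : ∀ m n z → fromℕ m ≤ p ⁻¹ * fromℕ (suc n) → 0# ≤ z → z ^ suc n ≈ Y ^ m → z ≤ G
      -- Exponent 0 is separate because the estimates below take m-th roots. Here `z` is 1.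
      bound zero n z _ 0≤z zⁿ≈1 = ≤-trans
        (^-cancelˡ-≤ (suc n) 0≤z 0≤1 (≤-reflexive (trans zⁿ≈1 (sym (1^n≈1 (suc n)))))) 1≤G
      bound m@(suc _) n z m≤N/p 0≤z zᴺ≈Yᵐ with total z G
      ... | inj₁ z≤G = z≤G
      -- If `z` reaches `G`, then G^N ≤ Y^m, and taking m-th roots gives both C d ≤ Y and τ ≤ ε Y.
      -- Adding them yields C (d + τ) ≤ (1 + C ε) Y ≤ C Y. The contradiction comes from d + τ being
      -- Y + 1, not Y: replacing one of the d ones by τ supplies the strictness that `G ≤ z` does
      -- not.
      ... | inj₂ G≤z = ⊥-elim $ x<x+1 Y $ *-cancelˡ-≤ (1≤x⇒0<x 1≤C) $ begin
        C * (Y + 1#)         ≈⟨ *-congˡ Y+1≈d+τ ⟩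
        C * (fromℕ d + τ)    ≈⟨ distribˡ C _ _ ⟩
        C * fromℕ d + C * τ  ≤⟨ +-mono-≤ Cd≤Y (*-monoˡ-≤ 0≤C τ≤εY) ⟩
        Y + C * (ε * Y)
          ≈⟨ solve 3 (λ Y C ε → Y :+ C :* (ε :* Y) := (con (+ 1) :+ C :* ε) :* Y) refl Y C ε ⟩
        (1# + C * ε) * Y     ≤⟨ *-monoʳ-≤ 0≤Y 1+Cε≤C ⟩
        C * Y                ∎
        where
        N = suc n

        pm≤N : p * fromℕ m ≤ fromℕ N
        pm≤N = begin
          p * fromℕ m           ≤⟨ *-monoˡ-≤ (proj₁ 0<p) m≤N/p ⟩
          p * (p ⁻¹ * fromℕ N)  ≈⟨ *-assoc _ _ _ ⟨
          p * p ⁻¹ * fromℕ N    ≈⟨ *-congʳ (⁻¹-inverse 0<p) ⟩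
          1# * fromℕ N          ≈⟨ *-identityˡ _ ⟩
          fromℕ N               ∎

        m≤N : m ℕ.≤ N
        m≤N = fromℕ-cancel-≤ m N $ begin
          fromℕ m       ≈⟨ *-identityˡ _ ⟨
          1# * fromℕ m  ≤⟨ *-monoʳ-≤ (fromℕ-nonNeg m) 1≤p ⟩
          p * fromℕ m   ≤⟨ pm≤N ⟩
          fromℕ N       ∎

        G^N≤Y^m : G ^ N ≤ Y ^ m
        G^N≤Y^m = ≤-trans (^-monoˡ-≤ N 0≤G G≤z) (≤-reflexive zᴺ≈Yᵐ)

        Cd≤Y : C * fromℕ d ≤ Y
        Cd≤Y = ^-cancelˡ-≤ m (*-nonNeg 0≤C (fromℕ-nonNeg d)) 0≤Y $ begin
          (C * fromℕ d) ^ m    ≈⟨ ^-distrib-* C (fromℕ d) m ⟩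
          C ^ m * fromℕ d ^ m  ≤⟨ *-mono-≤ (^-nonNeg m 0≤C) (^-nonNeg m (fromℕ-nonNeg d))
                                    (^-monoʳ-≤ 1≤C m≤N) (d^m≤E^n m N m≤N m≤N/p) ⟩
          C ^ N * E ^ N        ≈⟨ ^-distrib-* C E N ⟨
          G ^ N                ≤⟨ G^N≤Y^m ⟩
          Y ^ m                ∎

        τ≤εY : τ ≤ ε * Y
        τ≤εY = ^-cancelˡ-≤ m 0≤τ (*-nonNeg 0≤ε 0≤Y) $ begin
          τ ^ m          ≤⟨ power-≤ m N 1≤λ (proj₁ 0<p) lubτ pm≤N ⟩
          (ε * G) ^ N    ≈⟨ ^-distrib-* ε G N ⟩
          ε ^ N * G ^ N  ≤⟨ *-mono-≤ (^-nonNeg N 0≤ε) (^-nonNeg N 0≤G) (^-antiʳ-≤ 0≤ε ε≤1 m≤N) G^N≤Y^m ⟩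
          ε ^ m * Y ^ m  ≈⟨ ^-distrib-* ε Y m ⟨
          (ε * Y) ^ m    ∎

-- Diagonal matrices, orthogonal projections and PSD completions.

module LinearAlgebra (em : ExcludedMiddle 0ℓ) (ℝ : CompleteOrderedField) where
  open OrderedField em ℝ

  private
    variable
      d k : ℕ

  ·-cong : {u u′ v v′ : Vec d} → u ≋ u′ → v ≋ v′ → u · v ≈ u′ · v′
  ·-cong u≋u′ v≋v′ = sum-cong-≋ λ i → *-cong (u≋u′ i) (v≋v′ i)

  ·-congˡ : (u : Vec d) {v v′ : Vec d} → v ≋ v′ → u · v ≈ u · v′
  ·-congˡ u v≋v′ = sum-cong-≋ λ i → *-congˡ (v≋v′ i)

  ·-comm : (u v : Vec d) → u · v ≈ v · u
  ·-comm u v = sum-cong-≋ λ i → *-comm (u i) (v i)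

  ·-zeroˡ : (v : Vec d) → 0ᵛ · v ≈ 0#
  ·-zeroˡ {d} v = trans (sum-cong-≋ λ i → zeroˡ (v i)) (sum-replicate-zero d)

  ·-linearʳ : (u v w : Vec d) (c : Carrier) →
              u · (λ i → v i + w i * c) ≈ u · v + (u · w) * c
  ·-linearʳ u v w c = begin-equality
    u · (λ i → v i + w i * c)
      ≈⟨ sum-cong-≋ (λ i → solve 4 (λ u v w c →
           u :* (v :+ w :* c) := u :* v :+ u :* w :* c) refl (u i) (v i) (w i) c) ⟩
    sum (λ i → u i * v i + u i * w i * c)  ≈⟨ ∑-distrib-+ (λ i → u i * v i) _ ⟩
    u · v + sum (λ i → u i * w i * c)      ≈⟨ +-congˡ (*-distribʳ-sum c (λ i → u i * w i)) ⟨
    u · v + (u · w) * c                    ∎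

  ·-nonNeg : (v : Vec d) → 0# ≤ v · v
  ·-nonNeg v = sum-nonNeg λ i → 0≤x*x (v i)

  v·v≈0⇒v≋0 : (v : Vec d) → v · v ≈ 0# → v ≋ 0ᵛ
  v·v≈0⇒v≋0 v v·v≈0 i with em {v i ≈ 0#}
  ... | yes vᵢ≈0 = vᵢ≈0
  ... | no vᵢ≉0 = begin-equality
    v i                   ≈⟨ *-identityʳ _ ⟨
    v i * 1#              ≈⟨ *-congˡ (⁻¹-inverseʳ (v i) vᵢ≉0) ⟨
    v i * (v i * v i ⁻¹)  ≈⟨ *-assoc _ _ _ ⟨
    v i * v i * v i ⁻¹
      ≈⟨ *-congʳ (antisym (≤-trans (≤-sum (λ j → 0≤x*x (v j)) i) (≤-reflexive v·v≈0)) (0≤x*x (v i))) ⟩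
    0# * v i ⁻¹           ≈⟨ zeroˡ _ ⟩
    0#                    ∎

  selfAdjoint : {A : Matrix d} → Symmetric A → ∀ u v → u · A *ᵥ v ≈ (A *ᵥ u) · v
  selfAdjoint {A = A} A-sym u v = begin-equality
    u · A *ᵥ v                                 ≈⟨ sum-cong-≋ (λ i → *-distribˡ-sum (u i) (λ j → A i j * v j)) ⟩
    sum (λ i → sum λ j → u i * (A i j * v j))  ≈⟨ ∑-comm (λ i j → u i * (A i j * v j)) ⟩
    sum (λ j → sum λ i → u i * (A i j * v j))
      ≈⟨ sum-cong-≋ (λ j → sum-cong-≋ λ i → trans
           (solve 3 (λ u a v → u :* (a :* v) := a :* u :* v) refl (u i) (A i j) (v j))
           (*-congʳ (*-congʳ (A-sym i j)))) ⟩
    sum (λ j → sum λ i → A j i * u i * v j)    ≈⟨ sum-cong-≋ (λ j → *-distribʳ-sum (v j) (λ i → A j i * u i)) ⟨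
    (A *ᵥ u) · v                               ∎

  infixl 6 _+[_]_ᵀ

  -- The rank-one update A + c w wᵀ. It serves both the Gram-Schmidt step of `projector` and the
  -- Sherman-Morrison inverse of `completion`.
  _+[_]_ᵀ : Matrix d → Carrier → Vec d → Matrix d
  (A +[ c ] w ᵀ) i j = A i j + w i * w j * c

  rankOne-*ᵥ : (A : Matrix d) (c : Carrier) (w v : Vec d) →
               (A +[ c ] w ᵀ) *ᵥ v ≋ λ i → (A *ᵥ v) i + w i * ((w · v) * c)
  rankOne-*ᵥ A c w v i = begin-equality
    sum (λ j → (A i j + w i * w j * c) * v j)  ≈⟨ ·-comm _ v ⟩
    v · (λ j → A i j + w i * w j * c)
      ≈⟨ ·-congˡ v (λ j → +-congˡ
           (solve 3 (λ wᵢ wⱼ c → wᵢ :* wⱼ :* c := wⱼ :* (wᵢ :* c)) refl (w i) (w j) c)) ⟩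
    v · (λ j → A i j + w j * (w i * c))        ≈⟨ ·-linearʳ v (A i) w _ ⟩
    v · A i + (v · w) * (w i * c)              ≈⟨ +-cong (·-comm v (A i)) (*-congʳ (·-comm v w)) ⟩
    A i · v + (w · v) * (w i * c)
      ≈⟨ +-congˡ (solve 3 (λ q wᵢ c → q :* (wᵢ :* c) := wᵢ :* (q :* c)) refl (w · v) (w i) c) ⟩
    A i · v + w i * ((w · v) * c)              ∎

  δ : Fin d → Vec d
  δ i j = if does (i ≟ j) then 1# else 0#

  -- One shape serves for the diagonal of a hard instance, its signs, its singular values and their
  -- p-th powers.
  spike : Fin d → Carrier → Vec d
  spike i x j = if does (i ≟ j) then x else 1#

  δ-diagonal : (i : Fin d) → δ i i ≈ 1#
  δ-diagonal i with i ≟ i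
  ... | yes _  = refl
  ... | no i≢i = contradiction ≡.refl i≢i

  δ-off : {i j : Fin d} → i ≢ j → δ i j ≈ 0#
  δ-off {i = i} {j} i≢j with i ≟ j
  ... | yes i≡j = contradiction i≡j i≢j
  ... | no _    = refl

  spike-diagonal : ∀ (i : Fin d) x → spike i x i ≈ x
  spike-diagonal i x with i ≟ i
  ... | yes _  = refl
  ... | no i≢i = contradiction ≡.refl i≢i

  δ-sym : (i j : Fin d) → δ i j ≈ δ j i
  δ-sym i j with i ≟ j
  ... | yes ≡.refl = sym (δ-diagonal i)
  ... | no i≢j     = sym (δ-off (i≢j ∘ ≡.sym))

  spike-δ : ∀ (i : Fin d) x j → spike i x j ≈ 1# + (x - 1#) * δ i j
  spike-δ i x j with i ≟ j
  ... | yes _ = solve 1 (λ x → x := con (+ 1) :+ (x :- con (+ 1)) :* con (+ 1)) refl x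
  ... | no _  = solve 1 (λ x → con (+ 1) := con (+ 1) :+ (x :- con (+ 1)) :* con (+ 0)) refl x

  δ-· : ∀ (i : Fin d) v → δ i · v ≈ v i
  δ-· {suc d} zero v = begin-equality
    1# * v zero + 0ᵛ · (v ∘ suc)  ≈⟨ +-cong (*-identityˡ _) (·-zeroˡ (v ∘ suc)) ⟩
    v zero + 0#                   ≈⟨ +-identityʳ _ ⟩
    v zero                        ∎
  δ-· (suc i) v = trans (+-cong (zeroˡ _) (δ-· i (v ∘ suc))) (+-identityˡ _)

  sum-spike : ∀ (i : Fin d) x → sum (spike i x) + 1# ≈ fromℕ d + x
  sum-spike {d} i x = begin-equality
    sum (spike i x) + 1#
      ≈⟨ +-congʳ (sum-cong-≋ λ j → trans (spike-δ i x j) (+-congˡ (*-comm _ _))) ⟩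
    sum (λ j → 1# + δ i j * (x - 1#)) + 1#
      ≈⟨ +-congʳ (∑-distrib-+ (λ _ → 1#) (λ j → δ i j * (x - 1#))) ⟩
    sum (λ (j : Fin d) → 1#) + δ i · (λ _ → x - 1#) + 1#
      ≈⟨ +-congʳ (+-cong (sum-replicate d) (δ-· i (λ _ → x - 1#))) ⟩
    fromℕ d + (x - 1#) + 1#
      ≈⟨ solve 2 (λ d x → d :+ (x :- con (+ 1)) :+ con (+ 1) := d :+ x) refl (fromℕ d) x ⟩
    fromℕ d + x                                           ∎

  diag : Vec d → Matrix d
  diag a i j = a i * δ i j

  diag-*ᵥ : (a v : Vec d) → diag a *ᵥ v ≋ λ i → a i * v i
  diag-*ᵥ a v i = begin-equality
    sum (λ j → a i * δ i j * v j)    ≈⟨ sum-cong-≋ (λ j → *-assoc (a i) (δ i j) (v j)) ⟩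
    sum (λ j → a i * (δ i j * v j))  ≈⟨ *-distribˡ-sum (a i) (λ j → δ i j * v j) ⟨
    a i * (δ i · v)                  ≈⟨ *-congˡ (δ-· i v) ⟩
    a i * v i                        ∎

  diag-symmetric : (a : Vec d) → Symmetric (diag a)
  diag-symmetric a i j with i ≟ j
  ... | yes ≡.refl = *-congˡ (sym (δ-diagonal i))
  ... | no i≢j     = trans (zeroʳ _) (sym (trans (*-congˡ (δ-off (i≢j ∘ ≡.sym))) (zeroʳ _)))

  diag-orthogonal : (a : Vec d) → (∀ i → a i * a i ≈ 1#) → Orthogonal (diag a)
  diag-orthogonal a a²≈1 =
    (λ i → trans (columns i i) (trans (*-congˡ (δ-diagonal i)) (trans (*-identityʳ _) (a²≈1 i)))) ,
    (λ i j i≢j → trans (columns i j) (trans (*-congˡ (δ-off (i≢j ∘ ≡.sym))) (zeroʳ _)))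
    where
    columns : ∀ i j → sum (λ l → diag a l i * diag a l j) ≈ (a i * a i) * δ j i
    columns i j = begin-equality
      sum (λ l → a l * δ l i * (a l * δ l j))
        ≈⟨ sum-cong-≋ (λ l → trans (*-cong (*-congˡ (δ-sym l i)) (*-congˡ (δ-sym l j)))
             (solve 3 (λ a x y → a :* x :* (a :* y) := x :* (a :* a :* y)) refl (a l) (δ i l) (δ j l))) ⟩
      δ i · (λ l → a l * a l * δ j l)          ≈⟨ δ-· i _ ⟩
      (a i * a i) * δ j i                      ∎

  -- The signs `s` are absorbed into the left orthogonal factor and the right one is the identity,
  -- so the decomposition can be written down directly.
  diag-singularValues : (a s σ : Vec d) → (∀ i → a i ≈ s i * σ i) → (∀ i → s i * s i ≈ 1#) →
                        (∀ i → 0# ≤ σ i) → AreSingularValues (diag a) σ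
  diag-singularValues a s σ a≈sσ s²≈1 0≤σ = record
    { left             = diag s
    ; right            = diag λ _ → 1#
    ; left-orthogonal  = diag-orthogonal s s²≈1
    ; right-orthogonal = diag-orthogonal (λ _ → 1#) λ _ → *-identityʳ 1#
    ; nonNeg           = 0≤σ
    ; decomposition    = λ i j → sym $ begin-equality
        sum (λ l → s i * δ i l * σ l * (1# * δ j l))
          ≈⟨ sum-cong-≋ (λ l → solve 4 (λ s x σ y →
               s :* x :* σ :* (con (+ 1) :* y) := x :* (s :* σ :* y)) refl (s i) (δ i l) (σ l) (δ j l)) ⟩
        δ i · (λ l → s i * σ l * δ j l)               ≈⟨ δ-· i _ ⟩
        s i * σ i * δ j i                             ≈⟨ *-cong (sym (a≈sσ i)) (δ-sym j i) ⟩
        a i * δ i j                                   ∎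
    }

  diag-eigenvalue : (a : Vec d) (i : Fin d) → IsEigenvalue (diag a) (a i)
  diag-eigenvalue a i =
    δ i , (λ δ≋0 → 1≉0 (trans (sym (δ-diagonal i)) (δ≋0 i))) , λ j → trans (diag-*ᵥ a (δ i) j) (aδ≈aδ j)
    where
    aδ≈aδ : ∀ j → a j * δ i j ≈ a i * δ i j
    aδ≈aδ j with i ≟ j
    ... | yes ≡.refl = refl
    ... | no _       = trans (zeroʳ _) (sym (zeroʳ _))

  -- At a coordinate where an eigenvector does not vanish, its eigenvalue is that diagonal entry. An
  -- eigenvalue not above `a i` would therefore leave no nonzero coordinate.
  diag-smallestEigenvalue : (a : Vec d) (i : Fin d) → (∀ j → a i ≤ a j) →
                            IsSmallestEigenvalue (diag a) (a i)
  diag-smallestEigenvalue a i aᵢ≤a = diag-eigenvalue a i , λ { ν (v , v≉0 , Av≋νv) → least ν v v≉0 Av≋νv }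
    where
    least : ∀ ν v → ¬ v ≋ 0ᵛ → diag a *ᵥ v ≋ (λ j → ν * v j) → a i ≤ ν
    least ν v v≉0 Av≋νv with em {a i ≤ ν}
    ... | yes aᵢ≤ν = aᵢ≤ν
    ... | no aᵢ≰ν = ⊥-elim $ v≉0 λ j → vanishes j
      where
      vanishes : ∀ j → v j ≈ 0#
      vanishes j with em {v j ≈ 0#}
      ... | yes vⱼ≈0 = vⱼ≈0
      ... | no vⱼ≉0 = contradiction (≤-trans (aᵢ≤a j) (≤-reflexive aⱼ≈ν)) aᵢ≰ν
        where
        divide : ∀ c → c ≈ c * v j * v j ⁻¹
        divide c = sym (trans (*-assoc _ _ _) (trans (*-congˡ (⁻¹-inverseʳ (v j) vⱼ≉0)) (*-identityʳ c)))

        aⱼ≈ν : a j ≈ ν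
        aⱼ≈ν = begin-equality
          a j                 ≈⟨ divide (a j) ⟩
          a j * v j * v j ⁻¹  ≈⟨ *-congʳ (trans (sym (diag-*ᵥ a v j)) (Av≋νv j)) ⟩
          ν * v j * v j ⁻¹    ≈⟨ divide ν ⟨
          ν                   ∎

  -- This is A Q A for the diagonal matrix A with diagonal `a`.
  conjugate : Vec d → Matrix d → Matrix d
  conjugate a Q i j = a i * a j * Q i j

  conjugate-*ᵥ : (a : Vec d) (Q : Matrix d) (v : Vec d) →
                 conjugate a Q *ᵥ v ≋ λ i → a i * (Q *ᵥ (λ j → a j * v j)) i
  conjugate-*ᵥ a Q v i = begin-equality
    sum (λ j → a i * a j * Q i j * v j)
      ≈⟨ sum-cong-≋ (λ j → solve 4 (λ aᵢ aⱼ q v →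
           aᵢ :* aⱼ :* q :* v := aᵢ :* (q :* (aⱼ :* v))) refl (a i) (a j) (Q i j) (v j)) ⟩
    sum (λ j → a i * (Q i j * (a j * v j)))  ≈⟨ *-distribˡ-sum (a i) (λ j → Q i j * (a j * v j)) ⟨
    a i * (Q i · (λ j → a j * v j))          ∎

  conjugate-PSD : (a : Vec d) {Q : Matrix d} → PSD Q → PSD (conjugate a Q)
  conjugate-PSD a {Q} (Q-sym , Q≥0) = (λ i j → *-cong (*-comm (a i) (a j)) (Q-sym i j)) , λ v → begin
    0#                                            ≤⟨ Q≥0 (λ i → a i * v i) ⟩
    (λ i → a i * v i) · Q *ᵥ (λ i → a i * v i)
      ≈⟨ sum-cong-≋ (λ i →
           solve 3 (λ a v q → a :* v :* q := v :* (a :* q)) refl (a i) (v i) _) ⟩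
    v · (λ i → a i * (Q *ᵥ (λ j → a j * v j)) i)  ≈⟨ ·-congˡ v (conjugate-*ᵥ a Q v) ⟨
    v · conjugate a Q *ᵥ v                        ∎

  -- An orthogonal projection whose range contains every `v j`. Dimension enters only through the
  -- trace, which is what the counting argument sums.
  record Projector (v : Fin k → Vec d) : Set where
    field
      matrix     : Matrix d
      symmetric  : Symmetric matrix
      idempotent : ∀ u → matrix *ᵥ (matrix *ᵥ u) ≋ matrix *ᵥ u
      fixes      : ∀ j → matrix *ᵥ v j ≋ v j
      trace≤     : sum (λ i → matrix i i) ≤ fromℕ k

    column≋ : ∀ i → matrix *ᵥ δ i ≋ λ j → matrix j i
    column≋ i j = trans (·-comm (matrix j) (δ i)) (δ-· i (matrix j))

    quadraticForm : ∀ u → u · matrix *ᵥ u ≈ (matrix *ᵥ u) · (matrix *ᵥ u)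
    quadraticForm u = begin-equality
      u · matrix *ᵥ u                ≈⟨ ·-congˡ u (idempotent u) ⟨
      u · matrix *ᵥ (matrix *ᵥ u)    ≈⟨ selfAdjoint symmetric u _ ⟩
      (matrix *ᵥ u) · (matrix *ᵥ u)  ∎

    column·column : ∀ i → (λ j → matrix j i) · (λ j → matrix j i) ≈ matrix i i
    column·column i = begin-equality
      (λ j → matrix j i) · (λ j → matrix j i)  ≈⟨ ·-cong (column≋ i) (column≋ i) ⟨
      (matrix *ᵥ δ i) · (matrix *ᵥ δ i)        ≈⟨ quadraticForm (δ i) ⟨
      δ i · matrix *ᵥ δ i                      ≈⟨ δ-· i _ ⟩
      (matrix *ᵥ δ i) i                        ≈⟨ column≋ i i ⟩
      matrix i i                               ∎

    diagonal≥0 : ∀ i → 0# ≤ matrix i i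
    diagonal≥0 i = ≤-trans (·-nonNeg (λ j → matrix j i)) (≤-reflexive (column·column i))

  -- Gram-Schmidt, by induction on the number of vectors: the part `w` of the new vector orthogonal
  -- to the old range contributes w wᵀ / (w · w), of trace 1. If `w` vanishes, the old projection
  -- already fixes the new vector.
  projector : ∀ k (v : Fin k → Vec d) → Projector v
  projector {d} zero v = record
    { matrix     = λ _ _ → 0#
    ; symmetric  = λ _ _ → refl
    ; idempotent = λ u i → trans (·-zeroˡ ((λ _ → 0ᵛ) *ᵥ u)) (sym (·-zeroˡ u))
    ; fixes      = λ ()
    ; trace≤     = ≤-reflexive (sum-replicate-zero d)
    }
  projector {d} (suc k) v = extend (em {w ≋ 0ᵛ})
    where
    open Projector (projector k (v ∘ suc)) renaming (matrix to P)

    v₀ = v zero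

    w : Vec d
    w i = v₀ i - (P *ᵥ v₀) i

    v₀≋Pv₀+w : ∀ i → v₀ i ≈ (P *ᵥ v₀) i + w i
    v₀≋Pv₀+w i = solve 2 (λ x y → x := y :+ (x :- y)) refl (v₀ i) _

    Pw≋0 : P *ᵥ w ≋ 0ᵛ
    Pw≋0 i = begin-equality
      P i · w
        ≈⟨ ·-congˡ (P i) (λ j →
             solve 2 (λ x y → x :- y := x :+ y :* (:- con (+ 1))) refl (v₀ j) ((P *ᵥ v₀) j)) ⟩
      P i · (λ j → v₀ j + (P *ᵥ v₀) j * - 1#)  ≈⟨ ·-linearʳ (P i) v₀ _ _ ⟩
      (P *ᵥ v₀) i + (P *ᵥ (P *ᵥ v₀)) i * - 1#  ≈⟨ +-congˡ (*-congʳ (idempotent v₀ i)) ⟩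
      (P *ᵥ v₀) i + (P *ᵥ v₀) i * - 1#         ≈⟨ solve 1 (λ x → x :+ x :* (:- con (+ 1)) := con (+ 0)) refl _ ⟩
      0#                                       ∎

    w·Pu≈0 : ∀ u → w · P *ᵥ u ≈ 0#
    w·Pu≈0 u = begin-equality
      w · P *ᵥ u    ≈⟨ selfAdjoint symmetric w u ⟩
      (P *ᵥ w) · u  ≈⟨ ·-cong {v = u} Pw≋0 (λ _ → refl) ⟩
      0ᵛ · u        ≈⟨ ·-zeroˡ u ⟩
      0#            ∎

    extend : Dec (w ≋ 0ᵛ) → Projector v
    extend (yes w≋0) = record
      { matrix     = P
      ; symmetric  = symmetric
      ; idempotent = idempotent
      ; fixes      = λ { zero i → sym (trans (v₀≋Pv₀+w i) (trans (+-congˡ (w≋0 i)) (+-identityʳ _)))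
                       ; (suc j) → fixes j }
      ; trace≤     = ≤-trans trace≤ (≤-trans (x≤x+y 0≤1) (≤-reflexive (+-comm _ _)))
      }
    extend (no w≉0) = record
      { matrix     = P′
      ; symmetric  = λ i j → +-cong (symmetric i j) (*-congʳ (*-comm (w i) (w j)))
      ; idempotent = P′-idempotent
      ; fixes      = P′-fixes
      ; trace≤     = P′-trace≤
      }
      where
      c = (w · w) ⁻¹
      P′ = P +[ c ] w ᵀ

      w·w*c≈1 : (w · w) * c ≈ 1#
      w·w*c≈1 = ⁻¹-inverseʳ (w · w) (w≉0 ∘ v·v≈0⇒v≋0 w)

      -- The vectors P u + a w form the range of `P′`. Idempotence and the fixing of old and new
      -- vectors are all instances of this.
      fixes-+ : ∀ u a y → y ≋ (λ i → (P *ᵥ u) i + w i * a) → P′ *ᵥ y ≋ y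
      fixes-+ u a y y≋ i = begin-equality
        (P′ *ᵥ y) i                       ≈⟨ rankOne-*ᵥ P c w y i ⟩
        (P *ᵥ y) i + w i * ((w · y) * c)  ≈⟨ +-cong Py≈Pu (*-congˡ w·yc≈a) ⟩
        (P *ᵥ u) i + w i * a              ≈⟨ y≋ i ⟨
        y i                               ∎
        where
        Py≈Pu : (P *ᵥ y) i ≈ (P *ᵥ u) i
        Py≈Pu = begin-equality
          P i · y                             ≈⟨ ·-congˡ (P i) y≋ ⟩
          P i · (λ j → (P *ᵥ u) j + w j * a)  ≈⟨ ·-linearʳ (P i) _ w a ⟩
          (P *ᵥ (P *ᵥ u)) i + (P *ᵥ w) i * a  ≈⟨ +-cong (idempotent u i) (trans (*-congʳ (Pw≋0 i)) (zeroˡ a)) ⟩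
          (P *ᵥ u) i + 0#                     ≈⟨ +-identityʳ _ ⟩
          (P *ᵥ u) i                          ∎

        w·yc≈a : (w · y) * c ≈ a
        w·yc≈a = begin-equality
          (w · y) * c                             ≈⟨ *-congʳ (·-congˡ w y≋) ⟩
          (w · (λ j → (P *ᵥ u) j + w j * a)) * c  ≈⟨ *-congʳ (·-linearʳ w _ w a) ⟩
          (w · P *ᵥ u + (w · w) * a) * c          ≈⟨ *-congʳ (trans (+-congʳ (w·Pu≈0 u)) (+-identityˡ _)) ⟩
          (w · w) * a * c
            ≈⟨ solve 3 (λ n a c → n :* a :* c := n :* c :* a) refl (w · w) a c ⟩
          (w · w) * c * a                         ≈⟨ *-congʳ w·w*c≈1 ⟩
          1# * a                                  ≈⟨ *-identityˡ a ⟩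
          a                                       ∎

      P′-idempotent : ∀ u → P′ *ᵥ (P′ *ᵥ u) ≋ P′ *ᵥ u
      P′-idempotent u = fixes-+ u ((w · u) * c) (P′ *ᵥ u) (rankOne-*ᵥ P c w u)

      P′-fixes : ∀ j → P′ *ᵥ v j ≋ v j
      -- The new vector has coefficient 1 along `w`, the old ones have coefficient 0.
      P′-fixes zero    = fixes-+ v₀ 1# v₀ λ i → trans (v₀≋Pv₀+w i) (+-congˡ (sym (*-identityʳ _)))
      P′-fixes (suc j) = fixes-+ (v (suc j)) 0# (v (suc j)) λ i →
        sym (trans (+-cong (fixes j i) (zeroʳ _)) (+-identityʳ _))

      P′-trace≤ : sum (λ i → P′ i i) ≤ fromℕ (suc k)
      P′-trace≤ = begin
        sum (λ i → P i i + w i * w i * c)              ≈⟨ ∑-distrib-+ (λ i → P i i) _ ⟩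
        sum (λ i → P i i) + sum (λ i → w i * w i * c)  ≈⟨ +-congˡ (*-distribʳ-sum c (λ i → w i * w i)) ⟨
        sum (λ i → P i i) + (w · w) * c                ≈⟨ +-congˡ w·w*c≈1 ⟩
        sum (λ i → P i i) + 1#                         ≤⟨ +-monoˡ-≤ 1# trace≤ ⟩
        fromℕ k + 1#                                   ≈⟨ +-comm _ _ ⟩
        fromℕ (suc k)                                  ∎

  -- Let β = 1 - x.  If A = I - β eᵢ eᵢᵀ is positive definite on the range of P, then
  -- A P (P A P)⁻¹ P A, with the inverse taken on that range, is PSD and agrees with
  -- A there; the inverse is P + κ f fᵀ by the Sherman-Morrison formula.
  completion : {v : Fin k → Vec d} (Π : Projector v) (i : Fin d) {x : Carrier} → x ≤ 1# →
               (1# - x) * Projector.matrix Π i i < 1# →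
               ∃ λ B → PSD B × ∀ j → B *ᵥ v j ≋ diag (spike i x) *ᵥ v j
  completion {k = k} {d = d} {v} Π i {x} x≤1 (βt≤1 , βt≉1) =
    conjugate a Q , conjugate-PSD a (Q-symmetric , Q≥0) , agrees
    where
    open Projector Π renaming (matrix to P)

    a f : Vec d
    a = spike i x
    f j = P j i

    -- On the range, P A P acts as I - β f fᵀ with f = P eᵢ and f · f = t. So `γ` is the
    -- Sherman-Morrison denominator and `κ` the coefficient of f fᵀ in the inverse. The strict bound
    -- on β t makes `γ` positive, hence `κ` nonnegative.
    β t γ κ : Carrier
    β = 1# - x
    t = P i i
    γ = 1# - β * t
    κ = β * γ ⁻¹

    0<γ : 0# < γ
    0<γ = x≤y⇒0≤y-x βt≤1 , λ 0≈γ → βt≉1 (begin-equality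
      β * t    ≈⟨ solve 1 (λ x → x := con (+ 1) :- (con (+ 1) :- x)) refl (β * t) ⟩
      1# - γ   ≈⟨ +-congˡ (-‿cong (sym 0≈γ)) ⟩
      1# - 0#  ≈⟨ solve 0 (con (+ 1) :- con (+ 0) := con (+ 1)) refl ⟩
      1#       ∎)

    0≤κ : 0# ≤ κ
    0≤κ = *-nonNeg (x≤y⇒0≤y-x x≤1) (⁻¹-nonNeg 0<γ)

    Q : Matrix d
    Q = P +[ κ ] f ᵀ

    Q-symmetric : Symmetric Q
    Q-symmetric j l = +-cong (symmetric j l) (*-congʳ (*-comm (f j) (f l)))

    Q≥0 : ∀ u → 0# ≤ u · Q *ᵥ u
    Q≥0 u = begin
      0#
        ≤⟨ +-nonNeg (·-nonNeg (P *ᵥ u)) (*-nonNeg (0≤x*x (f · u)) 0≤κ) ⟩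
      (P *ᵥ u) · (P *ᵥ u) + ((f · u) * (f · u)) * κ  ≈⟨ +-cong (sym (quadraticForm u)) (*-assoc _ _ _) ⟩
      u · P *ᵥ u + (f · u) * ((f · u) * κ)           ≈⟨ +-congˡ (*-congʳ (·-comm f u)) ⟩
      u · P *ᵥ u + (u · f) * ((f · u) * κ)           ≈⟨ ·-linearʳ u (P *ᵥ u) f _ ⟨
      u · (λ j → (P *ᵥ u) j + f j * ((f · u) * κ))   ≈⟨ ·-congˡ u (rankOne-*ᵥ P κ f u) ⟨
      u · Q *ᵥ u                                     ∎

    module _ (j : Fin k) where
      y : Vec d
      y = v j

      f·y≈yᵢ : f · y ≈ y i
      f·y≈yᵢ = trans (sum-cong-≋ λ l → *-congʳ (symmetric l i)) (fixes j i)

      ay≋ : (λ l → a l * y l) ≋ λ l → y l + δ i l * - (β * y i)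
      ay≋ l with i ≟ l
      ... | yes ≡.refl = solve 2 (λ x y →
        x :* y := y :+ con (+ 1) :* (:- ((con (+ 1) :- x) :* y))) refl x (y i)
      ... | no _       = solve 3 (λ x yₗ yᵢ →
        con (+ 1) :* yₗ := yₗ :+ con (+ 0) :* (:- ((con (+ 1) :- x) :* yᵢ))) refl x (y l) (y i)

      -- Since A y = y - β yᵢ eᵢ, the inner product f · A y is γ yᵢ, and `κ` turns γ into β.
      f·ay*κ≈βyᵢ : (f · (λ l → a l * y l)) * κ ≈ β * y i
      f·ay*κ≈βyᵢ = begin-equality
        (f · (λ l → a l * y l)) * κ                  ≈⟨ *-congʳ (·-congˡ f ay≋) ⟩
        (f · (λ l → y l + δ i l * - (β * y i))) * κ  ≈⟨ *-congʳ (·-linearʳ f y (δ i) _) ⟩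
        (f · y + (f · δ i) * - (β * y i)) * κ
          ≈⟨ *-congʳ (+-cong f·y≈yᵢ (*-congʳ (trans (·-comm f (δ i)) (δ-· i f)))) ⟩
        (y i + t * - (β * y i)) * κ
          ≈⟨ solve 4 (λ y t β γ⁻¹ → (y :+ t :* (:- (β :* y))) :* (β :* γ⁻¹)
               := ((con (+ 1) :- β :* t) :* γ⁻¹) :* (β :* y)) refl (y i) t β (γ ⁻¹) ⟩
        γ * γ ⁻¹ * (β * y i)                         ≈⟨ *-congʳ (⁻¹-inverse 0<γ) ⟩
        1# * (β * y i)                               ≈⟨ *-identityˡ _ ⟩
        β * y i                                      ∎

      -- With B = A Q A it is enough that Q (A y) = y. Projecting A y gives y - β yᵢ f, and the
      -- rank-one term of `Q` restores exactly the missing β yᵢ f.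
      agrees : conjugate a Q *ᵥ y ≋ diag a *ᵥ y
      agrees l = begin-equality
        (conjugate a Q *ᵥ y) l                             ≈⟨ conjugate-*ᵥ a Q y l ⟩
        a l * (Q *ᵥ ay) l                                  ≈⟨ *-congˡ (rankOne-*ᵥ P κ f ay l) ⟩
        a l * ((P *ᵥ ay) l + f l * ((f · ay) * κ))         ≈⟨ *-congˡ (+-cong Pay≈ (*-congˡ f·ay*κ≈βyᵢ)) ⟩
        a l * (y l + f l * - (β * y i) + f l * (β * y i))
          ≈⟨ *-congˡ (solve 3 (λ y f z → y :+ f :* (:- z) :+ f :* z := y) refl (y l) (f l) (β * y i)) ⟩
        a l * y l                                          ≈⟨ diag-*ᵥ a y l ⟨
        (diag a *ᵥ y) l                                    ∎
        where
        ay : Vec d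
        ay l = a l * y l

        Pay≈ : (P *ᵥ ay) l ≈ y l + f l * - (β * y i)
        Pay≈ = begin-equality
          P l · ay                                 ≈⟨ ·-congˡ (P l) ay≋ ⟩
          P l · (λ m → y m + δ i m * - (β * y i))  ≈⟨ ·-linearʳ (P l) y (δ i) _ ⟩
          P l · y + (P l · δ i) * - (β * y i)      ≈⟨ +-cong (fixes j l) (*-congʳ (column≋ i l)) ⟩
          y l + f l * - (β * y i)                  ∎

-- Finite additivity and expected counts of events.

module Probability (em : ExcludedMiddle 0ℓ) (ℝ : CompleteOrderedField)
                   (𝒫 : Reals.ProbabilitySpace ℝ) where
  open OrderedField em ℝ
  open ProbabilitySpace 𝒫

  private
    variable
      E F : Pred Ω 0ℓ

    ∅-measurable : Measurable (∁ U)
    ∅-measurable = ∁-measurable U-measurable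

    -- Unions and additivity are given for countable families, so a pair of events is padded with
    -- the empty event.
    sequence : Pred Ω 0ℓ → Pred Ω 0ℓ → ℕ → Pred Ω 0ℓ
    sequence E F zero          = E
    sequence E F (suc zero)    = F
    sequence E F (suc (suc _)) = ∁ U

    sequence-measurable : Measurable E → Measurable F → ∀ n → Measurable (sequence E F n)
    sequence-measurable E-meas F-meas zero          = E-meas
    sequence-measurable E-meas F-meas (suc zero)    = F-meas
    sequence-measurable E-meas F-meas (suc (suc _)) = ∅-measurable

    sequence-disjoint : E ⊥ F → ∀ m n → m ≢ n → sequence E F m ⊥ sequence E F n
    sequence-disjoint E⊥F zero          zero          m≢n _       = m≢n ≡.refl
    sequence-disjoint E⊥F zero          (suc zero)    m≢n (e , f) = E⊥F (e , f)
    sequence-disjoint E⊥F (suc zero)    zero          m≢n (f , e) = E⊥F (e , f)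
    sequence-disjoint E⊥F (suc zero)    (suc zero)    m≢n _       = m≢n ≡.refl
    sequence-disjoint E⊥F (suc (suc _)) n             m≢n (ω∉U , _) = ω∉U tt
    sequence-disjoint E⊥F zero          (suc (suc _)) m≢n (_ , ω∉U) = ω∉U tt
    sequence-disjoint E⊥F (suc zero)    (suc (suc _)) m≢n (_ , ω∉U) = ω∉U tt

  -- De Morgan: an intersection is the complement of a union of complements.
  ∩-measurable : Measurable E → Measurable F → Measurable (E ∩ F)
  ∩-measurable {E} {F} E-meas F-meas =
    measurable-resp (⊆ , λ { (e , f) (zero , ¬e) → ¬e e
                         ; (e , f) (suc zero , ¬f) → ¬f f
                         ; _ (suc (suc _) , ω∉U) → ω∉U tt })
      (∁-measurable (⋃-measurable (sequence-measurable (∁-measurable E-meas) (∁-measurable F-meas))))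
    where
    ⊆ : ∀ {ω} → ω ∈ ∁ (⋃ ℕ (sequence (∁ E) (∁ F))) → ω ∈ E ∩ F
    ⊆ ω∉⋃ = decidable-stable em (λ ¬e → ω∉⋃ (0 , ¬e)) , decidable-stable em (λ ¬f → ω∉⋃ (1 , ¬f))

  -- The empty event is a disjoint union of copies of itself, so the partial sum of length 2 already
  -- gives twice its probability as a lower bound for it.
  pr-∅ : pr (∁ U) ≈ 0#
  pr-∅ = antisym (+-cancelʳ-≤ ∅ ∅+∅≤0+∅) (pr-nonNeg ∅-measurable)
    where
    ∅ = pr (∁ U)

    ∅+∅≤0+∅ : ∅ + ∅ ≤ 0# + ∅
    ∅+∅≤0+∅ = begin
      ∅ + ∅                 ≈⟨ +-congˡ (+-identityʳ _) ⟨
      ∅ + (∅ + 0#)          ≤⟨ proj₁ (pr-⋃ (λ _ → ∅-measurable) (λ _ _ _ (ω∉U , _) → ω∉U tt)) _ (2 , refl) ⟩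
      pr (⋃ ℕ (λ _ → ∁ U))  ≈⟨ pr-cong (proj₂ , (0 ,_)) (⋃-measurable (λ _ → ∅-measurable)) ⟩
      ∅                     ≈⟨ +-identityˡ ∅ ⟨
      0# + ∅                ∎

  pr-disjoint : Measurable E → Measurable F → E ⊥ F → pr (⋃ ℕ (sequence E F)) ≈ pr E + pr F
  pr-disjoint {E} {F} E-meas F-meas E⊥F = antisym
    (least (pr E + pr F) λ { x (n , x≈) → ≤-trans (≤-reflexive x≈) (partialSum n) })
    (≤-trans (≤-reflexive (+-congˡ (sym (+-identityʳ _)))) (upper _ (2 , refl)))
    where
    lub = pr-⋃ (sequence-measurable E-meas F-meas) (sequence-disjoint E⊥F)
    upper = proj₁ lub
    least = proj₂ lub

    partialSum : ∀ n → sum {n} (λ i → pr (sequence E F (toℕ i))) ≤ pr E + pr F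
    partialSum zero          = +-nonNeg (pr-nonNeg E-meas) (pr-nonNeg F-meas)
    partialSum (suc zero)    = +-monoʳ-≤ _ (pr-nonNeg F-meas)
    partialSum (suc (suc n)) = +-monoʳ-≤ _ $ begin
      pr F + sum {n} (λ _ → pr (∁ U))  ≈⟨ +-congˡ (sum-cong-≋ {n} λ _ → pr-∅) ⟩
      pr F + sum {n} (λ _ → 0#)        ≈⟨ +-congˡ (sum-replicate-zero n) ⟩
      pr F + 0#                        ≈⟨ +-identityʳ _ ⟩
      pr F                             ∎

  pr-split : Measurable E → Measurable F → pr E ≈ pr (E ∩ F) + pr (E ∩ ∁ F)
  pr-split {E} {F} E-meas F-meas = trans (pr-cong (⊆ , ⊇) E-meas)
    (pr-disjoint (∩-measurable E-meas F-meas) (∩-measurable E-meas (∁-measurable F-meas))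
                 (λ ((_ , f) , (_ , ¬f)) → ¬f f))
    where
    ⊆ : ∀ {ω} → ω ∈ E → ω ∈ ⋃ ℕ (sequence (E ∩ F) (E ∩ ∁ F))
    ⊆ {ω} e with em {ω ∈ F}
    ... | yes f = 0 , e , f
    ... | no ¬f = 1 , e , ¬f

    ⊇ : ∀ {ω} → ω ∈ ⋃ ℕ (sequence (E ∩ F) (E ∩ ∁ F)) → ω ∈ E
    ⊇ (zero , e , _)      = e
    ⊇ (suc zero , e , _)  = e
    ⊇ (suc (suc _) , ω∉U) = ⊥-elim (ω∉U tt)

  Fails : (Ω → Bool) → Pred Ω 0ℓ
  Fails b ω = b ω ≡ false

  failure : Bool → Carrier
  failure b = if b then 0# else 1#

  -- Linearity of expectation without integrals, by induction on the number of events. Splitting `E`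
  -- by the first event leaves a budget of `N - 1#` where it occurs and `N` elsewhere, which is why
  -- both `E` and `N` must vary.
  expectedFailures-on : ∀ {n} (b : Fin n → Ω → Bool) → (∀ i → Measurable (Fails (b i))) →
    ∀ {E} → Measurable E → ∀ N → (∀ ω → ω ∈ E → sum (λ i → failure (b i ω)) ≤ N) →
    sum (λ i → pr (E ∩ Fails (b i))) ≤ N * pr E
  -- The budget may have become negative, but only over an empty event, whose probability is 0.
  expectedFailures-on {zero} b b-meas {E} E-meas N bound with em {∃ E}
  ... | yes (ω , ω∈E) = *-nonNeg (bound ω ω∈E) (pr-nonNeg E-meas)
  ... | no E-empty    = ≤-reflexive $ begin-equality
    0#            ≈⟨ zeroʳ N ⟨
    N * 0#        ≈⟨ *-congˡ pr-∅ ⟨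
    N * pr (∁ U)
      ≈⟨ *-congˡ (pr-cong ((λ ω∉U → ⊥-elim (ω∉U tt)) , λ e → ⊥-elim (E-empty (_ , e))) ∅-measurable) ⟩
    N * pr E      ∎
  expectedFailures-on {suc n} b b-meas {E} E-meas N bound = begin
    pr E₁ + sum (λ i → pr (E ∩ Fails (c i)))  ≈⟨ +-congˡ (sum-cong-≋ split) ⟩
    pr E₁ + sum (λ i → pr (E₁ ∩ Fails (c i)) + pr (E₂ ∩ Fails (c i)))
      ≈⟨ +-congˡ (∑-distrib-+ (λ i → pr (E₁ ∩ Fails (c i))) (λ i → pr (E₂ ∩ Fails (c i)))) ⟩
    pr E₁ + (sum (λ i → pr (E₁ ∩ Fails (c i))) + sum (λ i → pr (E₂ ∩ Fails (c i))))
      ≤⟨ +-monoʳ-≤ _ (+-mono-≤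
           (expectedFailures-on c (b-meas ∘ suc) E₁-meas (N - 1#) bound₁)
           (expectedFailures-on c (b-meas ∘ suc) E₂-meas N bound₂)) ⟩
    pr E₁ + ((N - 1#) * pr E₁ + N * pr E₂)
      ≈⟨ solve 3 (λ x y N → x :+ ((N :- con (+ 1)) :* x :+ N :* y) := N :* (x :+ y)) refl (pr E₁) (pr E₂) N ⟩
    N * (pr E₁ + pr E₂)                       ≈⟨ *-congˡ (pr-split E-meas (b-meas zero)) ⟨
    N * pr E                                  ∎
    where
    c : Fin n → Ω → Bool
    c = b ∘ suc

    E₁ E₂ : Pred Ω 0ℓ
    E₁ = E ∩ Fails (b zero)
    E₂ = E ∩ ∁ (Fails (b zero))

    E₁-meas : Measurable E₁
    E₁-meas = ∩-measurable E-meas (b-meas zero)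

    E₂-meas : Measurable E₂
    E₂-meas = ∩-measurable E-meas (∁-measurable (b-meas zero))

    split : ∀ i → pr (E ∩ Fails (c i)) ≈ pr (E₁ ∩ Fails (c i)) + pr (E₂ ∩ Fails (c i))
    split i = trans (pr-split E∩-meas (b-meas zero)) $ +-cong
      (pr-cong swap (∩-measurable E∩-meas (b-meas zero)))
      (pr-cong swap (∩-measurable E∩-meas (∁-measurable (b-meas zero))))
      where
      E∩-meas = ∩-measurable E-meas (b-meas (suc i))

      swap : ∀ {F : Pred Ω 0ℓ} → (E ∩ Fails (c i)) ∩ F ≐ (E ∩ F) ∩ Fails (c i)
      swap = (λ ((e , f) , g) → (e , g) , f) , λ ((e , g) , f) → (e , f) , g

    bound₁ : ∀ ω → ω ∈ E₁ → sum (λ i → failure (c i ω)) ≤ N - 1#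
    bound₁ ω (e , f) = +-cancelʳ-≤ 1# $ begin
      sum (λ i → failure (c i ω)) + 1#                  ≈⟨ +-comm _ 1# ⟩
      1# + sum (λ i → failure (c i ω))
        ≡⟨ ≡.cong (λ x → failure x + sum (λ i → failure (c i ω))) f ⟨
      failure (b zero ω) + sum (λ i → failure (c i ω))  ≤⟨ bound ω e ⟩
      N
        ≈⟨ solve 1 (λ N → N := (N :- con (+ 1)) :+ con (+ 1)) refl N ⟩
      (N - 1#) + 1#                                     ∎

    failure-nonNeg : ∀ x → 0# ≤ failure x
    failure-nonNeg true  = ≤-refl
    failure-nonNeg false = 0≤1

    bound₂ : ∀ ω → ω ∈ E₂ → sum (λ i → failure (c i ω)) ≤ N
    bound₂ ω (e , _) = ≤-trans (≤-trans (x≤x+y (failure-nonNeg (b zero ω))) (≤-reflexive (+-comm _ _))) (bound ω e)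

  expectedFailures : ∀ {n} (b : Fin n → Ω → Bool) → (∀ i → Measurable (Fails (b i))) →
    ∀ N → (∀ ω → sum (λ i → failure (b i ω)) ≤ N) → sum (λ i → pr (Fails (b i))) ≤ N
  expectedFailures b b-meas N bound = begin
    sum (λ i → pr (Fails (b i)))      ≈⟨ sum-cong-≋ (λ i → pr-cong ((tt ,_) , proj₂) (b-meas i)) ⟩
    sum (λ i → pr (U ∩ Fails (b i)))  ≤⟨ expectedFailures-on b b-meas U-measurable N (λ ω _ → bound ω) ⟩
    N * pr U                          ≈⟨ *-congˡ pr-U ⟩
    N * 1#                            ≈⟨ *-identityʳ N ⟩
    N                                 ∎

-- The hard instances and the query bound.

module HardInstances (em : ExcludedMiddle 0ℓ) (ℝ : CompleteOrderedField) where
  open OrderedField em ℝ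
  open RealPowers em ℝ
  open LinearAlgebra em ℝ

  private
    variable
      d k : ℕ

  hardInstance : Fin d → Carrier → Matrix d
  hardInstance i μ = diag (spike i (- μ))

  -- Two spikes are compared entrywise, as for bases and their powers. Properties of a single spike
  -- take a constant second spike, hence `y = 1#` in their uses.
  spike-elim : ∀ (R : Carrier → Carrier → Set) {x y} → R x y → R 1# 1# →
               ∀ (i j : Fin d) → R (spike i x j) (spike i y j)
  spike-elim R Rxy R11 i j with i ≟ j
  ... | yes _ = Rxy
  ... | no _  = R11

  hardInstance-singularValues : ∀ (i : Fin d) {μ} → 0# ≤ μ → AreSingularValues (hardInstance i μ) (spike i μ)
  hardInstance-singularValues i {μ} 0≤μ = diag-singularValues _ (spike i (- 1#)) (spike i μ) a≈sσ
    (λ j → spike-elim (λ s _ → s * s ≈ 1#) {y = 1#}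
             (solve 0 ((:- con (+ 1)) :* (:- con (+ 1)) := con (+ 1)) refl) (*-identityʳ 1#) i j)
    (λ j → spike-elim (λ σ _ → 0# ≤ σ) {y = 1#} 0≤μ 0≤1 i j)
    where
    a≈sσ : ∀ j → spike i (- μ) j ≈ spike i (- 1#) j * spike i μ j
    a≈sσ j with i ≟ j
    ... | yes _ = sym (-1*x≈-x μ)
    ... | no _  = sym (*-identityʳ 1#)

  IsPow-1 : ∀ {p} → 0# ≤ p → IsPow 1# p 1#
  IsPow-1 0≤p = base≥1 ≤-refl 0≤p
    ( (λ { z (m , n , _ , 0≤z , zⁿ≈1) → ^-cancelˡ-≤ (suc n) 0≤z 0≤1
             (≤-reflexive (trans zⁿ≈1 (trans (1^n≈1 m) (sym (1^n≈1 (suc n)))))) })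
    , λ b upper → upper 1# (1∈RationalPowers 0≤p) )

  hardInstance-far : ∀ (p : Exponent) (i : Fin d) {ε μ s} → 1# ≤ μ →
                     IsℓNorm p (spike i μ) s → ε * s ≤ μ → IsFar p ε (hardInstance i μ)
  hardInstance-far p i {ε} {μ} {s} 1≤μ norm εs≤μ =
    s , spike i (- μ) i
    , (spike i μ , hardInstance-singularValues i 0≤μ , norm)
    , diag-smallestEigenvalue (spike i (- μ)) i smallest
    , (≤-trans (≤-reflexive aᵢ≈-μ) -μ≤0 , λ aᵢ≈0 → proj₂ 0<μ (antisym 0≤μ (μ≤0 aᵢ≈0)))
    , (begin
        spike i (- μ) i  ≈⟨ aᵢ≈-μ ⟩
        - μ              ≤⟨ neg-mono-≤ εs≤μ ⟩
        - (ε * s)        ∎)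
    where
    0≤μ = 1≤x⇒0≤x 1≤μ
    0<μ = 1≤x⇒0<x 1≤μ

    aᵢ≈-μ : spike i (- μ) i ≈ - μ
    aᵢ≈-μ = spike-diagonal i (- μ)

    -μ≤0 : - μ ≤ 0#
    -μ≤0 = ≤-trans (neg-mono-≤ 0≤μ) (≤-reflexive -0#≈0#)

    μ≤0 : spike i (- μ) i ≈ 0# → μ ≤ 0#
    μ≤0 aᵢ≈0 = ≤-reflexive $ begin-equality
      μ      ≈⟨ -‿involutive μ ⟨
      - - μ  ≈⟨ -‿cong (trans (sym aᵢ≈-μ) aᵢ≈0) ⟩
      - 0#   ≈⟨ -0#≈0# ⟩
      0#     ∎

    smallest : ∀ j → spike i (- μ) i ≤ spike i (- μ) j
    smallest j = ≤-trans (≤-reflexive aᵢ≈-μ)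
      (spike-elim (λ a _ → - μ ≤ a) {y = 1#} ≤-refl (≤-trans -μ≤0 0≤1) i j)

  module _ {k} (𝒜 : NonAdaptiveAlgorithm d k) (oneSided : IsOneSided 𝒜) where
    open NonAdaptiveAlgorithm 𝒜

    -- One-sidedness holds for each outcome of the coins separately, so the PSD matrix that imitates
    -- the input may depend on `ω` through the queries. If the bound failed, the algorithm would see
    -- the same answers as for that matrix and have to accept.
    rejected⇒ : ∀ ω (Π : Projector (query ω)) i {x} → x ≤ 1# → run (diag (spike i x)) ω ≡ false →
                1# ≤ (1# - x) * Projector.matrix Π i i
    rejected⇒ ω Π i {x} x≤1 rejected = decidable-stable em λ 1≰βt →
      inconsistent (completion Π i x≤1 (≰⇒≥ 1≰βt , λ βt≈1 → 1≰βt (≤-reflexive (sym βt≈1))))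
      where
      inconsistent : ¬ ∃ λ B → PSD B × ∀ j → B *ᵥ query ω j ≋ diag (spike i x) *ᵥ query ω j
      inconsistent (B , B-PSD , agrees) = contradiction
        (≡.trans (≡.sym (oneSided B ω B-PSD)) (≡.trans (decide-cong ω agrees) rejected)) λ ()

    open Probability em ℝ coins

    expectedRejections : ∀ {x} → x ≤ 1# →
      sum (λ i → pr (Outputs false (diag (spike i x)))) ≤ (1# - x) * fromℕ k
    expectedRejections {x} x≤1 =
      expectedFailures (λ i → run (diag (spike i x)))
        (λ i → outputs-measurable false (diag (spike i x)) (diag-symmetric (spike i x))) _ λ ω →
      let Π = projector k (query ω)
          open Projector Π in begin
      sum (λ i → failure (run (diag (spike i x)) ω))
        ≤⟨ sum-mono-≤ (λ i → failure≤ ω Π i (run (diag (spike i x)) ω) ≡.refl) ⟩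
      sum (λ i → (1# - x) * matrix i i)               ≈⟨ *-distribˡ-sum (1# - x) (λ i → matrix i i) ⟨
      (1# - x) * sum (λ i → matrix i i)               ≤⟨ *-monoˡ-≤ 0≤β trace≤ ⟩
      (1# - x) * fromℕ k                              ∎
      where
      0≤β : 0# ≤ 1# - x
      0≤β = x≤y⇒0≤y-x x≤1

      failure≤ : ∀ ω (Π : Projector (query ω)) i b → run (diag (spike i x)) ω ≡ b →
                 failure b ≤ (1# - x) * Projector.matrix Π i i
      failure≤ ω Π i true  _        = *-nonNeg 0≤β (Projector.diagonal≥0 Π i)
      failure≤ ω Π i false rejected = rejected⇒ ω Π i x≤1 rejected

  upperBound₂ : ∀ x y → ∃ λ z → x ≤ z × y ≤ z
  upperBound₂ x y with total x y
  ... | inj₁ x≤y = y , x≤y , ≤-refl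
  ... | inj₂ y≤x = x , ≤-refl , y≤x

  module _ {ε C D E : Carrier} .{{_ : NonZero d}} where
    -- For p = ∞ the largest singular value is μ itself, because 1 ≤ μ, and ε ≤ 1 suffices. For
    -- finite p, 1 ≤ μ keeps every base at least 1, so the powers come from `power` and the estimate
    -- from `schatten-≤`.
    hardInstance-norm : ∀ p → 0# < ε → ε ≤ 1# → 1# ≤ C → 1# + C * ε ≤ C →
      IsPow (fromℕ d) (1# - 1/ p) D → E * D ≈ fromℕ d → 0# ≤ E → 1# ≤ ε * (C * E) →
      ∀ (i : Fin d) → ∃ λ s → IsℓNorm p (spike i (ε * (C * E))) s × ε * s ≤ ε * (C * E)
    hardInstance-norm ∞ 0<ε ε≤1 _ _ _ _ _ 1≤μ i =
      μ , ((λ j → spike-elim (λ σ _ → σ ≤ μ) {y = 1#} ≤-refl 1≤μ i j) , i , sym (spike-diagonal i μ))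
        , (begin
            ε * μ   ≤⟨ *-monoʳ-≤ (1≤x⇒0≤x 1≤μ) ε≤1 ⟩
            1# * μ  ≈⟨ *-identityˡ μ ⟩
            μ       ∎)
      where μ = ε * (C * E)
    hardInstance-norm (finite p 1≤p) 0<ε ε≤1 1≤C 1+Cε≤C powD ED≈d 0≤E 1≤μ i =
      s , (spike i τ , pow-τ , base≥1 1≤Y 0≤p⁻¹ lub-s)
        , *-monoˡ-≤ (proj₁ 0<ε) (schatten-≤ {d = d} 1≤p 0<ε ε≤1 1≤C 1+Cε≤C
            (proj₂ (IsPow⇒lub (1≤fromℕ d) powD)) ED≈d 0≤E 1≤μ lub-τ Y+1≈d+τ lub-s)
      where
      μ = ε * (C * E)

      0<p : 0# < p
      0<p = 1≤x⇒0<x 1≤p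

      0≤p⁻¹ : 0# ≤ p ⁻¹
      0≤p⁻¹ = ⁻¹-nonNeg 0<p

      τ : Carrier
      τ = proj₁ (power 1≤μ (proj₁ 0<p))

      lub-τ : IsLub (RationalPowers μ p) τ
      lub-τ = proj₂ (power 1≤μ (proj₁ 0<p))

      pow-τ : ∀ j → IsPow (spike i μ j) p (spike i τ j)
      pow-τ = spike-elim (λ x y → IsPow x p y) (base≥1 1≤μ (proj₁ 0<p) lub-τ) (IsPow-1 (proj₁ 0<p)) i

      Y : Carrier
      Y = sum (spike i τ)

      Y+1≈d+τ : Y + 1# ≈ fromℕ d + τ
      Y+1≈d+τ = sum-spike i τ

      1≤Y : 1# ≤ Y
      1≤Y = +-cancelʳ-≤ 1# $ begin
        1# + 1#      ≤⟨ +-mono-≤ (1≤fromℕ d) (1≤power (proj₁ 0<p) lub-τ) ⟩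
        fromℕ d + τ  ≈⟨ Y+1≈d+τ ⟨
        Y + 1#       ∎

      s : Carrier
      s = proj₁ (power 1≤Y 0≤p⁻¹)

      lub-s : IsLub (RationalPowers Y (p ⁻¹)) s
      lub-s = proj₂ (power 1≤Y 0≤p⁻¹)

  -- Multiplying by 3 C ε E, which is 3 μ, clears all inverses and leaves d ≤ 3 μ k.
  queries-≥ : ∀ {ε C D K} p → 0# < ε → ε ≤ 1# → 1# ≤ C → 1# + C * ε ≤ C → K ≤ C →
    ∀ .{{_ : NonZero d}} → IsPow (fromℕ d) (1# - 1/ p) D → ε ⁻¹ * D ≤ K * fromℕ d →
    (𝒜 : NonAdaptiveAlgorithm d k) → IsTester ε p 𝒜 → IsOneSided 𝒜 →
    (fromℕ 3 * C) ⁻¹ * (ε ⁻¹ * D) ≤ fromℕ k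
  queries-≥ {d = d} {k = k} {ε} {C} {D} {K} p 0<ε ε≤1 1≤C 1+Cε≤C K≤C powD D/ε≤Kd 𝒜 tester oneSided =
    *-cancelˡ-≤ (*-pos (*-pos 0<3C 0<ε) 0<E) $ begin
    3C * ε * E * (3C ⁻¹ * (ε ⁻¹ * D))
      ≈⟨ solve 6 (λ c c⁻¹ ε ε⁻¹ E D → c :* ε :* E :* (c⁻¹ :* (ε⁻¹ :* D))
           := (c :* c⁻¹) :* (ε :* ε⁻¹) :* (E :* D)) refl 3C (3C ⁻¹) ε (ε ⁻¹) E D ⟩
    (3C * 3C ⁻¹) * (ε * ε ⁻¹) * (E * D)  ≈⟨ *-cong (*-cong (⁻¹-inverse 0<3C) (⁻¹-inverse 0<ε)) ED≈d ⟩
    1# * 1# * fromℕ d                    ≈⟨ solve 1 (λ d → con (+ 1) :* con (+ 1) :* d := d) refl (fromℕ d) ⟩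
    fromℕ d                              ≤⟨ *-cancelˡ-≤ (fromℕ-pos 2) 2d≤6μk ⟩
    fromℕ 3 * (μ * fromℕ k)
      ≈⟨ solve 5 (λ t C ε E k → t :* (ε :* (C :* E) :* k) := t :* C :* ε :* E :* k)
           refl (fromℕ 3) C ε E (fromℕ k) ⟩
    3C * ε * E * fromℕ k                 ∎
    where
    open NonAdaptiveAlgorithm 𝒜
    open IsTester tester

    3C E μ : Carrier
    3C = fromℕ 3 * C
    -- This is d^(1/p), obtained from the given power D = d^(1-1/p).
    E = fromℕ d * D ⁻¹
    μ = ε * (C * E)

    0<C : 0# < C
    0<C = 1≤x⇒0<x 1≤C

    0<3C : 0# < 3C
    0<3C = *-pos (fromℕ-pos 3) 0<C

    D-lub : 0# ≤ 1# - 1/ p × IsLub (RationalPowers (fromℕ d) (1# - 1/ p)) D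
    D-lub = IsPow⇒lub (1≤fromℕ d) powD

    0<D : 0# < D
    0<D = 1≤x⇒0<x (1≤power (proj₁ D-lub) (proj₂ D-lub))

    0<E : 0# < E
    0<E = *-pos (fromℕ-pos d) (⁻¹-pos 0<D)

    ED≈d : E * D ≈ fromℕ d
    ED≈d = begin-equality
      fromℕ d * D ⁻¹ * D    ≈⟨ *-assoc _ _ _ ⟩
      fromℕ d * (D ⁻¹ * D)  ≈⟨ *-congˡ (trans (*-comm _ _) (⁻¹-inverse 0<D)) ⟩
      fromℕ d * 1#          ≈⟨ *-identityʳ _ ⟩
      fromℕ d               ∎

    1≤μ : 1# ≤ μ
    1≤μ = *-cancelˡ-≤ 0<D $ begin
      D * 1#             ≈⟨ *-congˡ (⁻¹-inverse 0<ε) ⟨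
      D * (ε * ε ⁻¹)     ≈⟨ solve 3 (λ D ε ε⁻¹ → D :* (ε :* ε⁻¹) := ε :* (ε⁻¹ :* D)) refl D ε (ε ⁻¹) ⟩
      ε * (ε ⁻¹ * D)     ≤⟨ *-monoˡ-≤ (proj₁ 0<ε) D/ε≤Kd ⟩
      ε * (K * fromℕ d)  ≤⟨ *-monoˡ-≤ (proj₁ 0<ε) (*-monoʳ-≤ (fromℕ-nonNeg d) K≤C) ⟩
      ε * (C * fromℕ d)  ≈⟨ *-congˡ (*-congˡ ED≈d) ⟨
      ε * (C * (E * D))  ≈⟨ solve 4 (λ D ε C E → ε :* (C :* (E :* D)) := D :* (ε :* (C :* E))) refl D ε C E ⟩
      D * μ              ∎

    far : ∀ i → IsFar p ε (hardInstance i μ)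
    far i =
      let _ , norm , εs≤μ = hardInstance-norm p 0<ε ε≤1 1≤C 1+Cε≤C powD ED≈d (proj₁ 0<E) 1≤μ i
      in hardInstance-far p i 1≤μ norm εs≤μ

    -μ≤1 : - μ ≤ 1#
    -μ≤1 = ≤-trans (neg-mono-≤ (1≤x⇒0≤x 1≤μ)) (≤-trans (≤-reflexive -0#≈0#) 0≤1)

    -- The factor 3 clears the denominator of `2/3`. The factor 2 is its numerator on the left,
    -- comes from 1 + μ ≤ 2 μ on the right, and is cancelled by the caller.
    2d≤6μk : fromℕ 2 * fromℕ d ≤ fromℕ 2 * (fromℕ 3 * (μ * fromℕ k))
    2d≤6μk = begin
      fromℕ 2 * fromℕ d                             ≈⟨ *-identityˡ _ ⟨
      1# * (fromℕ 2 * fromℕ d)                      ≈⟨ *-congʳ (⁻¹-inverse (fromℕ-pos 3)) ⟨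
      (fromℕ 3 * fromℕ 3 ⁻¹) * (fromℕ 2 * fromℕ d)
        ≈⟨ solve 4 (λ t t⁻¹ u d → t :* t⁻¹ :* (u :* d) := t :* (d :* (u :* t⁻¹)))
             refl (fromℕ 3) (fromℕ 3 ⁻¹) (fromℕ 2) (fromℕ d) ⟩
      fromℕ 3 * (fromℕ d * 2/3)                     ≈⟨ *-congˡ (*-congʳ (sum-replicate d)) ⟨
      fromℕ 3 * (sum (λ (_ : Fin d) → 1#) * 2/3)
        ≈⟨ *-congˡ (trans (*-distribʳ-sum 2/3 (λ (_ : Fin d) → 1#)) (sum-cong-≋ {d} λ _ → *-identityˡ 2/3)) ⟩
      fromℕ 3 * sum (λ (_ : Fin d) → 2/3)
        ≤⟨ *-monoˡ-≤ (fromℕ-nonNeg 3) (sum-mono-≤ λ i →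
             rejects (hardInstance i μ) (diag-symmetric (spike i (- μ))) (far i)) ⟩
      fromℕ 3 * sum (λ i → pr (Outputs false (hardInstance i μ)))
        ≤⟨ *-monoˡ-≤ (fromℕ-nonNeg 3) (expectedRejections 𝒜 oneSided -μ≤1) ⟩
      fromℕ 3 * ((1# - - μ) * fromℕ k)
        ≤⟨ *-monoˡ-≤ (fromℕ-nonNeg 3) (*-monoʳ-≤ (fromℕ-nonNeg k) 1+μ≤2μ) ⟩
      fromℕ 3 * (fromℕ 2 * μ * fromℕ k)
        ≈⟨ solve 4 (λ t u μ k → t :* (u :* μ :* k) := u :* (t :* (μ :* k)))
             refl (fromℕ 3) (fromℕ 2) μ (fromℕ k) ⟩
      fromℕ 2 * (fromℕ 3 * (μ * fromℕ k))           ∎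
      where
      1+μ≤2μ : 1# - - μ ≤ fromℕ 2 * μ
      1+μ≤2μ = begin
        1# - - μ     ≤⟨ +-monoˡ-≤ (- - μ) 1≤μ ⟩
        -- `fromℕ 2` unfolds to `1# + (1# + 0#)`, so the coefficient is spelled out in this form
        -- instead of `con (+ 2)`.
        μ - - μ      ≈⟨ solve 1 (λ μ → μ :- (:- μ) := (con (+ 1) :+ (con (+ 1) :+ con (+ 0))) :* μ) refl μ ⟩
        fromℕ 2 * μ  ∎

  -- The condition on `ε` says C (1 - ε) ≥ 1, which is tightest at ε₀. So any C above both `K` and 1
  -- / (1 - ε₀) will do.
  scale-exists : ∀ {ε₀} K → ε₀ < 1# →
    ∃ λ C → 0# < C × K ≤ C × (∀ {ε} → 0# < ε → ε ≤ ε₀ → 1# + C * ε ≤ C)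
  scale-exists {ε₀} K (ε₀≤1 , ε₀≉1) with upperBound₂ K ((1# - ε₀) ⁻¹)
  ... | C , K≤C , [1-ε₀]⁻¹≤C = C , 0<C , K≤C , λ {ε} 0<ε ε≤ε₀ → begin
    1# + C * ε                         ≤⟨ +-monoʳ-≤ 1# (*-monoˡ-≤ (proj₁ 0<C) ε≤ε₀) ⟩
    1# + C * ε₀                        ≈⟨ +-congʳ (⁻¹-inverse 0<1-ε₀) ⟨
    (1# - ε₀) * (1# - ε₀) ⁻¹ + C * ε₀  ≤⟨ +-monoˡ-≤ (C * ε₀) (*-monoˡ-≤ (proj₁ 0<1-ε₀) [1-ε₀]⁻¹≤C) ⟩
    (1# - ε₀) * C + C * ε₀             ≈⟨ solve 2 (λ ε C → (con (+ 1) :- ε) :* C :+ C :* ε := C) refl ε₀ C ⟩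
    C                                  ∎
    where
    0<1-ε₀ : 0# < 1# - ε₀
    0<1-ε₀ = x≤y⇒0≤y-x ε₀≤1 , λ 0≈1-ε₀ → ε₀≉1 (sym (x∙y⁻¹≈ε⇒x≈y 1# ε₀ (sym 0≈1-ε₀)))

    0<C : 0# < C
    0<C = <-≤-trans (⁻¹-pos 0<1-ε₀) [1-ε₀]⁻¹≤C

-- Querying a basis reveals the whole matrix, so d queries always suffice and a bound of order D / ε
-- can hold only where D / ε is at most a constant multiple of d. `K` is that constant. The
-- resulting `c` depends on `ε₀` and `K` alone, hence is uniform in p, ε and d.
corollary46 :
    ExcludedMiddle 0ℓ →
    (ℝ : CompleteOrderedField) →
    let open CompleteOrderedField ℝ
        open Reals ℝ
    in
    (ε₀ K : Carrier) → ε₀ < 1# →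
    ∃ λ (c : Carrier) → 0# < c ×
      ((p : Exponent) (ε : Carrier) → 0# < ε → ε ≤ ε₀ →
       (d k : ℕ) .{{_ : NonZero d}} →
       (D : Carrier) → IsPow (fromℕ d) (1# - 1/ p) D →
       ε ⁻¹ * D ≤ K * fromℕ d →
       (𝒜 : NonAdaptiveAlgorithm d k) → IsTester ε p 𝒜 → IsOneSided 𝒜 →
       c * (ε ⁻¹ * D) ≤ fromℕ k)
corollary46 em ℝ ε₀ K ε₀<1 =
  let C , 0<C , K≤C , 1+Cε≤C = scale-exists K ε₀<1 in
  (fromℕ 3 * C) ⁻¹ , ⁻¹-pos (*-pos (fromℕ-pos 3) 0<C) ,
  λ p ε 0<ε ε≤ε₀ d k D powD D/ε≤Kd 𝒜 tester oneSided →
  queries-≥ p 0<ε (≤-trans ε≤ε₀ (proj₁ ε₀<1))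
    -- The bound 1 ≤ C is read off from 1 + C ε ≤ C, as C ε is nonnegative.
    (≤-trans (x≤x+y (*-nonNeg (proj₁ 0<C) (proj₁ 0<ε))) (1+Cε≤C 0<ε ε≤ε₀)) (1+Cε≤C 0<ε ε≤ε₀)
    K≤C powD D/ε≤Kd 𝒜 tester oneSided
  where
  open OrderedField em ℝ
  open HardInstances em ℝ
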